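{- Let $h\geq 2$ be an integer and $\varepsilon>0$. Then there exists $$\alpha>\frac{1}{\max\left(36h^2/\varepsilon+18,\ 8h+1\right)}$$ such that $$\#\left\{n<N:\ \frac{s_F(n^h)}{s_F(n)}<\varepsilon\right\}\gg N^{\alpha},$$ where the implied constant does not depend on $N$.
   Context: Let $(F_j)_{j\geq 0}$ be the Fibonacci numbers, $F_0=0$, $F_1=1$, $F_{j+1}=F_j+F_{j-1}$. Every positive integer $x$ has a unique Zeckendorf expansion $x=\sum_{2\leq j\leq M}\varepsilon_jF_j$ with $\varepsilon_M=1$, $\varepsilon_j\in\{0,1\}$ and no two adjacent digits equal to $1$. The Zeckendorf sum of digits is $s_F(x)=\sum_j\varepsilon_j$.
   Formalization: The number ε > 0 is taken to be rational rather than an arbitrary positive real. -}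

module Defs where

open import Data.Nat as ℕ using (ℕ; zero; suc; _∸_; _≤?_)
open import Data.Integer using (+_)
open import Data.Rational using (ℚ; _/_; _<_; _*_; _+_; _⊔_; 1/_; Positive; 0ℚ; 1ℚ)
open import Data.Rational.Properties using (_<?_; pos⇒nonZero)
open import Data.List using (List; length; filter; applyUpTo)
open import Relation.Nullary using (yes; no)

F : ℕ → ℕ
F zero = 0
F (suc zero) = 1
F (suc (suc j)) = F (suc j) ℕ.+ F j

-- largest Fibonacci number F_j (j ≥ 2) that is ≤ n, for n ≥ 1.
-- a = F_j ≤ n, b = F_{j+1}; the fuel argument bounds the number of steps.
largestFib : (fuel n a b : ℕ) → ℕ
largestFib zero n a b = a
largestFib (suc k) n a b with b ≤? n
... | yes _ = largestFib k n b (a ℕ.+ b)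
... | no _  = a

-- Zeckendorf sum of digits, computed by the greedy algorithm (which produces
-- exactly the Zeckendorf expansion): s_F(0) = 0 and for n ≥ 1,
-- s_F(n) = 1 + s_F(n - F_k) with F_k the largest Fibonacci number ≤ n.
sFfuel : (fuel n : ℕ) → ℕ
sFfuel zero n = 0
sFfuel (suc k) zero = 0
sFfuel (suc k) (suc m) = suc (sFfuel k (suc m ∸ largestFib (suc m) (suc m) (F 2) (F 3)))

sF : ℕ → ℕ
sF n = sFfuel n n

⟦_⟧ : ℕ → ℚ
⟦ n ⟧ = + n / 1

_^ℚ_ : ℚ → ℕ → ℚ
q ^ℚ zero = 1ℚ
q ^ℚ suc k = q * (q ^ℚ k)

-- #{ 1 ≤ n < N : s_F(n^h) / s_F(n) < ε }   (ratio compared as s_F(n^h) < ε·s_F(n), s_F(n) > 0)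
count : (h : ℕ) (ε : ℚ) (N : ℕ) → ℕ
count h ε N = length (filter (λ n → ⟦ sF (n ℕ.^ h) ⟧ <? ε * ⟦ sF n ⟧) (applyUpTo suc (N ∸ 1)))

-- M(h, ε) = max(36 h² / ε + 18, 8h + 1)  (a positive rational);
-- the condition α > 1/M is expressed as 1 < α · M.
M : (h : ℕ) (ε : ℚ) .{{_ : Positive ε}} → ℚ
M h ε = (⟦ 36 ℕ.* h ℕ.* h ⟧ * (1/ ε) {{pos⇒nonZero ε}} + ⟦ 18 ⟧) ⊔ ⟦ 8 ℕ.* h ℕ.+ 1 ⟧

{-# OPTIONS --safe #-}

-- For even k = 2κ consider n = 2 L_{2k} + b L_k − 1 with 3 ≤ b < L_{2m} and κ = K m; this is the value at
-- x = φ^k of the Laurent polynomial T = 2x² + bx − 1 + bx⁻¹ + 2x⁻². For h ≥ 2 the coefficients of T^h are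
-- non-negative, so n^h is a sum of 4h + 1 terms t F_j with t ≤ (2b + 3)^h, and each of these is a sum of
-- O(h m) Fibonacci numbers, independently of k. On the other hand the −1 forces about k/2 − O(m) digits in n.
-- Hence the ratio is below ε once K is a suitable multiple of h²/ε, and there are about L_{2m} admissible b
-- while n is about φ^{4Km}, which gives the exponent 1/(2K).
module Submission where

open import Defs

-- The outer coefficient 2 and the condition b ≥ 3 come from the cube. With outer coefficient a the
-- constant term of T³ is 6(a - 1)b² - 6a² - 1: this is -7 for a = 1, while a = 2 gives 6b² - 25,
-- which is non-negative from b = 3 on. Once T² and T³ have no negative coefficient, neither has any
-- T^h with h ≥ 2. The number φ^k is irrational, and T has negative exponents and a negative
-- coefficient, yet the argument stays in ℕ. Polynomials act on integer sequences instead of being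
-- evaluated: on a sequence with w(j + 2) + w(j) = 3 w(j + 1), multiplication by L_{2p} is the shift
-- by p plus the shift by -p, without signs because the index 2p is even. The sequence used is
-- F_{2i+1}: at negative i its values are again Fibonacci numbers, and at i = 0 its value is 1, so
-- that n^h itself can be read off there. The -1 is never applied: n + 1 acts as T + 1, and n², n³
-- are recovered by cancelling equal terms.

module Arithmetic where

  open import Data.Fin using (Fin; toℕ)
  open import Data.Fin.Properties using (injective⇒≤; toℕ-injective; toℕ<n)
  open import Data.List using (List; []; _∷_; map; length; filter; applyUpTo; lookup)
  open import Data.List.Membership.Propositional using (_∈_)
  open import Data.List.Membership.Propositional.Properties using (∈-filter⁺; ∈-applyUpTo⁺)
  open import Data.List.Properties using (length-map)
  open import Data.List.Relation.Unary.Any using (index)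
  open import Data.List.Relation.Unary.Any.Properties using (lookup-index)
  open import Data.Nat
  open import Data.Nat.Induction using (<-wellFounded)
  open import Data.Nat.ListAction using (sum)
  open import Data.Nat.Properties
  open import Data.Nat.Tactic.RingSolver using (solve-∀; solve)
  open import Data.Product using (∃; _×_; _,_; proj₁; proj₂)
  open import Induction.WellFounded using (Acc; acc)
  open import Relation.Binary.PropositionalEquality
  open import Relation.Nullary using (yes; no; contradiction)
  open import Relation.Unary using (Decidable)

  -- Fibonacci numbers and the greedy algorithm

  F-suc : ∀ j → F j ≤ F (suc j)
  F-suc zero = z≤n
  F-suc (suc zero) = ≤-refl
  F-suc (suc (suc j)) = m≤m+n _ _

  F-+ : ∀ i d → F i ≤ F (d + i)
  F-+ i zero = ≤-refl
  F-+ i (suc d) = ≤-trans (F-+ i d) (F-suc (d + i))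

  F-mono : ∀ {i j} → i ≤ j → F i ≤ F j
  F-mono {i} {j} i≤j = subst (λ k → F i ≤ F k) (m∸n+n≡m i≤j) (F-+ i (j ∸ i))

  F-pos : ∀ j → 1 ≤ F (suc j)
  F-pos j = F-mono {1} {suc j} (s≤s z≤n)

  -- Makes the fuel in `largestFib` sufficient: the search for the leading term of n ends within n
  -- steps.
  n<F : ∀ n → n < F (2 + n)
  n<F zero = s≤s z≤n
  n<F (suc n) = subst (_≤ F (3 + n)) (+-comm (suc n) 1) (+-mono-≤ (n<F n) (F-pos n))

  largestFib-spec : ∀ k {n} i → F (2 + i) ≤ n → n < F (k + (3 + i)) →
    ∃ λ j → largestFib k n (F (2 + i)) (F (3 + i)) ≡ F (2 + j) × F (2 + j) ≤ n × n < F (3 + j)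
  largestFib-spec zero i lo hi = i , refl , lo , hi
  largestFib-spec (suc k) {n} i lo hi with F (3 + i) ≤? n
  ... | no ≰n = i , refl , lo , ≰⇒> ≰n
  ... | yes ≤n rewrite +-comm (F (2 + i)) (F (3 + i)) =
    largestFib-spec k (suc i) ≤n (subst (λ x → n < F x) (sym (+-suc k (3 + i))) hi)

  Fib-bracket-unique : ∀ {n} i j → F (2 + i) ≤ n → n < F (3 + i) → F (2 + j) ≤ n → n < F (3 + j) → i ≡ j
  Fib-bracket-unique i j li hi lj hj = ≤-antisym (le li hj) (le lj hi)
    where
    le : ∀ {n i j} → F (2 + i) ≤ n → n < F (3 + j) → i ≤ j
    le {n} {i} {j} l h = ≮⇒≥ λ j<i → <⇒≱ h (≤-trans (F-mono (s≤s (s≤s j<i))) l)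

  greedy-spec : ∀ m → ∃ λ j → largestFib (suc m) (suc m) (F 2) (F 3) ≡ F (2 + j) × F (2 + j) ≤ suc m × suc m < F (3 + j)
  greedy-spec m = largestFib-spec (suc m) 0 (s≤s z≤n)
    (subst (λ x → suc m < F x) (+-comm 3 (suc m)) (≤-trans (n<F (suc m)) (F-suc (3 + m))))

  greedy-∸ : ∀ m → suc m ∸ largestFib (suc m) (suc m) (F 2) (F 3) ≤ m
  greedy-∸ m with greedy-spec m
  ... | j , eq , _ , _ rewrite eq = ∸-monoʳ-≤ (suc m) (F-pos (suc j))

  sFfuel-irrelevant : ∀ k l n → n ≤ k → n ≤ l → sFfuel k n ≡ sFfuel l n
  sFfuel-irrelevant zero zero zero _ _ = refl
  sFfuel-irrelevant zero (suc l) zero _ _ = refl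
  sFfuel-irrelevant (suc k) zero zero _ _ = refl
  sFfuel-irrelevant (suc k) (suc l) zero _ _ = refl
  sFfuel-irrelevant (suc k) (suc l) (suc m) (s≤s p) (s≤s q) =
    cong suc (sFfuel-irrelevant k l _ (≤-trans (greedy-∸ m) p) (≤-trans (greedy-∸ m) q))

  -- The only form in which the definition of `sF` is used below; with `greedy-split` it replaces
  -- any explicit representation of Zeckendorf digits.
  sF-greedy : ∀ j r → r < F (1 + j) → sF (F (2 + j) + r) ≡ suc (sF r)
  sF-greedy j r r< = go (F (2 + j) + r) refl
    where
    go : ∀ n → n ≡ F (2 + j) + r → sF n ≡ suc (sF r)
    go zero eq = contradiction (≤-trans (F-pos (suc j)) (≤-trans (m≤m+n _ r) (≤-reflexive (sym eq)))) λ ()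
    go (suc m) eq = cong suc (trans (sFfuel-irrelevant m (suc m ∸ lF) _ (greedy-∸ m) ≤-refl) (cong sF rem))
      where
      lF = largestFib (suc m) (suc m) (F 2) (F 3)
      spec = greedy-spec m
      j≡ : proj₁ spec ≡ j
      j≡ = Fib-bracket-unique _ j (proj₁ (proj₂ (proj₂ spec))) (proj₂ (proj₂ (proj₂ spec)))
        (subst (F (2 + j) ≤_) (sym eq) (m≤m+n _ r)) (subst (_< F (3 + j)) (sym eq) (+-monoʳ-< (F (2 + j)) r<))
      rem : suc m ∸ lF ≡ r
      rem = begin
        suc m ∸ lF              ≡⟨ cong (suc m ∸_) (trans (proj₁ (proj₂ spec)) (cong (λ i → F (2 + i)) j≡)) ⟩
        suc m ∸ F (2 + j)       ≡⟨ cong (_∸ F (2 + j)) eq ⟩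
        F (2 + j) + r ∸ F (2 + j) ≡⟨ m+n∸m≡n (F (2 + j)) r ⟩
        r ∎
        where open ≡-Reasoning

  greedy-split : ∀ m → ∃ λ j → ∃ λ r → suc m ≡ F (2 + j) + r × r < F (1 + j)
  greedy-split m with greedy-spec m
  ... | j , _ , lo , hi = j , suc m ∸ F (2 + j) , sym (m+[n∸m]≡n lo) ,
    +-cancelˡ-< (F (2 + j)) _ _ (subst (_< F (3 + j)) (sym (m+[n∸m]≡n lo)) hi)

  -- Subadditivity of the Zeckendorf digit sum

  sF-F : ∀ j → sF (F j) ≤ 1
  sF-F zero = z≤n
  sF-F (suc zero) = ≤-refl
  sF-F (suc (suc j)) = ≤-reflexive (trans (cong sF (sym (+-identityʳ (F (2 + j))))) (sF-greedy j 0 (F-pos j)))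

  -- Adding F_j to n = F_{i+2} + r either leaves the leading term alone, or carries into F_{i+3}
  -- through F_{i+2} + F_{i+1} = F_{i+3} or 2 F_{i+2} = F_{i+3} + F_i.
  sF-+F : ∀ n j → sF (n + F j) ≤ suc (sF n)
  sF-+F n j = go n (<-wellFounded n) j
    where
    go : ∀ n → Acc _<_ n → ∀ j → sF (n + F j) ≤ suc (sF n)
    go zero _ j = sF-F j
    go n@(suc m) (acc rs) j with greedy-split m
    ... | i , r , n≡ , r< = cases
      where
      open ≤-Reasoning
      sn : sF n ≡ suc (sF r)
      sn = trans (cong sF n≡) (sF-greedy i r r<)
      r<n : r < n
      r<n = subst (r <_) (sym n≡) (+-monoˡ-≤ r (F-pos (suc i)))
      n+F : n + F j ≡ F (2 + i) + (r + F j)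
      n+F = trans (cong (_+ F j) n≡) (+-assoc (F (2 + i)) r (F j))
      ih : sF (r + F j) ≤ sF n
      ih = subst (sF (r + F j) ≤_) (sym sn) (go r (rs r<n) j)
      -- This carry is free: r + F_j and n + F_j have different leading terms but the same remainder
      -- r', hence equal digit sums.
      carry : ∀ i r' → r + F j ≡ F (1 + i) + r' → r' < F i → n + F j ≡ F (2 + i) + (r + F j) → sF (n + F j) ≤ suc (sF n)
      carry zero r' _ () _
      carry (suc i) r' eq r'< n+F = begin
        sF (n + F j)                       ≡⟨ cong sF n+F ⟩
        sF (F (3 + i) + (r + F j))         ≡⟨ cong (λ x → sF (F (3 + i) + x)) eq ⟩
        sF (F (3 + i) + (F (2 + i) + r'))  ≡⟨ cong sF (+-assoc (F (3 + i)) _ r') ⟨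
        sF (F (4 + i) + r')                ≡⟨ sF-greedy (2 + i) r' (≤-trans r'< (≤-trans (F-suc (1 + i)) (F-suc (2 + i)))) ⟩
        suc (sF r')                        ≡⟨ sF-greedy i r' r'< ⟨
        sF (F (2 + i) + r')                ≡⟨ cong sF eq ⟨
        sF (r + F j)                       ≤⟨ ih ⟩
        sF n                               ≤⟨ n≤1+n _ ⟩
        suc (sF n)                         ∎
      low : j ≤ i → sF (n + F j) ≤ suc (sF n)
      low j≤i with r + F j <? F (1 + i)
      ... | yes small = ≤-trans (≤-reflexive (trans (cong sF n+F) (sF-greedy i _ small))) (s≤s ih)
      ... | no big = carry i (r + F j ∸ F (1 + i)) (sym (m+[n∸m]≡n (≮⇒≥ big)))
        (+-cancelˡ-< (F (1 + i)) _ _ (subst (_< F (2 + i)) (sym (m+[n∸m]≡n (≮⇒≥ big))) (+-mono-<-≤ r< (F-mono j≤i)))) n+F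
      n< : n < F (3 + i)
      n< = subst (_< F (3 + i)) (sym n≡) (+-monoʳ-< (F (2 + i)) r<)
      swap : ∀ x y r → x + r + y ≡ x + y + r
      swap = solve-∀
      double : ∀ x y r → x + y + r + (x + y) ≡ (x + y) + x + (r + y)
      double = solve-∀
      high : ∀ d → sF (n + F (suc i + d)) ≤ suc (sF n)
      high 0 rewrite +-identityʳ i = begin
        sF (n + F (1 + i))             ≡⟨ cong (λ x → sF (x + F (1 + i))) n≡ ⟩
        sF (F (2 + i) + r + F (1 + i)) ≡⟨ cong sF (swap (F (2 + i)) _ r) ⟩
        sF (F (3 + i) + r)             ≡⟨ sF-greedy (1 + i) r (≤-trans r< (F-suc (1 + i))) ⟩
        suc (sF r)                     ≡⟨ sn ⟨
        sF n                           ≤⟨ n≤1+n _ ⟩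
        suc (sF n)                     ∎
      high 1 rewrite +-comm i 1 = begin
        sF (n + F (2 + i))             ≡⟨ cong (λ x → sF (x + F (2 + i))) n≡ ⟩
        sF (F (2 + i) + r + F (2 + i)) ≡⟨ cong sF (double (F (1 + i)) (F i) r) ⟩
        sF (F (3 + i) + (r + F i))     ≡⟨ sF-greedy (1 + i) (r + F i) (+-monoˡ-< (F i) r<) ⟩
        suc (sF (r + F i))             ≤⟨ s≤s (go r (rs r<n) i) ⟩
        suc (suc (sF r))               ≡⟨ cong suc sn ⟨
        suc (sF n)                     ∎
      high 2 rewrite +-comm i 2 = begin
        sF (n + F (3 + i))             ≡⟨ cong (λ x → sF (x + F (3 + i))) n≡ ⟩
        sF (F (2 + i) + r + F (3 + i)) ≡⟨ cong sF (trans (swap (F (2 + i)) _ r) (cong (_+ r) (+-comm (F (2 + i)) _))) ⟩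
        sF (F (4 + i) + r)             ≡⟨ sF-greedy (2 + i) r (≤-trans r< (≤-trans (F-suc (1 + i)) (F-suc (2 + i)))) ⟩
        suc (sF r)                     ≡⟨ sn ⟨
        sF n                           ≤⟨ n≤1+n _ ⟩
        suc (sF n)                     ∎
      -- F_j now lies at least two indices above the leading term of n, so it is a new leading
      -- digit.
      high (suc (suc (suc d))) rewrite +-comm i (3 + d) = ≤-reflexive
        (trans (cong sF (+-comm n _)) (sF-greedy (2 + d + i) n (≤-trans n< (F-mono (s≤s (s≤s (s≤s (m≤n+m i d))))))))
      cases : sF (n + F j) ≤ suc (sF n)
      cases with j ≤? i
      ... | yes j≤i = low j≤i
      ... | no j≰i with m≤n⇒∃[o]m+o≡n (≰⇒> j≰i)
      ...   | d , eq = subst (λ j → sF (n + F j) ≤ suc (sF n)) eq (high d)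

  sF-+ : ∀ m n → sF (m + n) ≤ sF m + sF n
  sF-+ m n = go n (<-wellFounded n)
    where
    go : ∀ n → Acc _<_ n → sF (m + n) ≤ sF m + sF n
    go zero _ = ≤-reflexive (trans (cong sF (+-identityʳ m)) (sym (+-identityʳ _)))
    go n@(suc k) (acc rs) with greedy-split k
    ... | i , r , n≡ , r< = begin
      sF (m + n)               ≡⟨ cong (λ x → sF (m + x)) n≡ ⟩
      sF (m + (F (2 + i) + r)) ≡⟨ cong sF (swap m (F (2 + i)) r) ⟩
      sF (m + r + F (2 + i))   ≤⟨ sF-+F (m + r) (2 + i) ⟩
      suc (sF (m + r))         ≤⟨ s≤s (go r (rs (subst (r <_) (sym n≡) (+-monoˡ-≤ r (F-pos (suc i)))))) ⟩
      suc (sF m + sF r)        ≡⟨ +-suc (sF m) (sF r) ⟨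
      sF m + suc (sF r)        ≡⟨ cong (sF m +_) (trans (cong sF n≡) (sF-greedy i r r<)) ⟨
      sF m + sF n              ∎
      where
      open ≤-Reasoning
      swap : ∀ m x r → m + (x + r) ≡ m + r + x
      swap = solve-∀

  -- Fibonacci and Lucas numbers in steps of two

  Rec : (ℕ → ℕ) → Set
  Rec w = ∀ j → w (2 + j) + w j ≡ 3 * w (1 + j)

  -- Odd indices, because Fibonacci numbers of odd negative index are positive; those of even
  -- negative index are not.
  e : ℕ → ℕ
  e i = F (1 + 2 * i)

  F-step : ∀ j → F (4 + j) + F j ≡ 3 * F (2 + j)
  F-step j = lem (F (1 + j)) (F j)
    where
    lem : ∀ x y → x + y + x + (x + y) + y ≡ 3 * (x + y)
    lem = solve-∀

  e-suc : ∀ i → e (suc i) ≡ F (3 + 2 * i)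
  e-suc i = cong (λ x → F (suc x)) (*-suc 2 i)

  e-rec : Rec e
  e-rec j = subst₂ (λ x y → x + e j ≡ 3 * y)
    (sym (trans (e-suc (suc j)) (cong (λ x → F (3 + x)) (*-suc 2 j)))) (sym (e-suc j)) (F-step (1 + 2 * j))

  -- E W j is e (j - W), where e is extended to negative indices by F_{-(2i+1)} = F_{2i+1}.
  E : ℕ → ℕ → ℕ
  E zero j = e j
  E (suc W) zero = e W
  E (suc W) (suc j) = E W j

  E-rec : ∀ W → Rec (E W)
  E-rec zero = e-rec
  E-rec (suc zero) zero = refl
  E-rec (suc (suc W)) zero = trans (+-comm (E W 0) (e (suc W))) (go W)
    where
    go : ∀ W → e (suc W) + E W 0 ≡ 3 * e W
    go zero = refl
    go (suc W) = e-rec W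
  E-rec (suc W) (suc j) = E-rec W j

  E-shift : ∀ p W j → E (p + W) (p + j) ≡ E W j
  E-shift zero W j = refl
  E-shift (suc p) W j = E-shift p W j

  E-diagonal : ∀ W → E W W ≡ 1
  E-diagonal zero = refl
  E-diagonal (suc W) = E-diagonal W

  E-Fib : ∀ W j → ∃ λ i → E W j ≡ F i
  E-Fib zero j = 1 + 2 * j , refl
  E-Fib (suc W) zero = 1 + 2 * W , refl
  E-Fib (suc W) (suc j) = E-Fib W j

  -- The Lucas numbers of even index: Λ p = L_{2p}.
  Λ : ℕ → ℕ
  Λ zero = 2
  Λ (suc p) = e (suc p) + e p

  Λ-rec : Rec Λ
  Λ-rec zero = refl
  Λ-rec (suc j) = begin
    e (3 + j) + e (2 + j) + (e (1 + j) + e j)   ≡⟨ swap (e (3 + j)) (e (2 + j)) _ _ ⟩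
    e (3 + j) + e (1 + j) + (e (2 + j) + e j)   ≡⟨ cong₂ _+_ (e-rec (1 + j)) (e-rec j) ⟩
    3 * e (2 + j) + 3 * e (1 + j)               ≡⟨ *-distribˡ-+ 3 (e (2 + j)) _ ⟨
    3 * (e (2 + j) + e (1 + j))                 ∎
    where
    open ≡-Reasoning
    swap : ∀ a b c d → a + b + (c + d) ≡ a + c + (b + d)
    swap = solve-∀

  Λ-* : ∀ w → Rec w → ∀ p j → Λ p * w (p + j) ≡ w (p + (p + j)) + w j
  Λ-* w rec zero j = cong (w j +_) (+-identityʳ (w j))
  Λ-* w rec (suc zero) j = sym (rec j)
  Λ-* w rec (suc (suc p)) j = +-cancelʳ-≡ (Λ p * X) _ _ (begin
    Λ (2 + p) * X + Λ p * X                            ≡⟨ *-distribʳ-+ X (Λ (2 + p)) (Λ p) ⟨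
    (Λ (2 + p) + Λ p) * X                              ≡⟨ cong (_* X) (Λ-rec p) ⟩
    3 * Λ (1 + p) * X                                  ≡⟨ *-assoc 3 (Λ (1 + p)) X ⟩
    3 * (Λ (1 + p) * X)                                ≡⟨ cong (λ i → 3 * (Λ (1 + p) * w i)) (idx₁ p j) ⟩
    3 * (Λ (1 + p) * w (1 + p + (1 + j)))              ≡⟨ cong (3 *_) (Λ-* w rec (suc p) (suc j)) ⟩
    3 * (w (1 + p + (1 + p + (1 + j))) + w (1 + j))    ≡⟨ *-distribˡ-+ 3 (w (1 + p + (1 + p + (1 + j)))) _ ⟩
    3 * w (1 + p + (1 + p + (1 + j))) + 3 * w (1 + j)  ≡⟨ cong (λ i → 3 * w i + 3 * w (1 + j)) (idx₂ p j) ⟩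
    3 * w (1 + (p + (2 + p + j))) + 3 * w (1 + j)      ≡⟨ cong₂ _+_ (rec (p + (2 + p + j))) (rec j) ⟨
    w (2 + p + (2 + p + j)) + w (p + (2 + p + j)) + (w (2 + j) + w j) ≡⟨ swap (w (2 + p + (2 + p + j))) _ _ _ ⟩
    w (2 + p + (2 + p + j)) + w j + (w (p + (2 + p + j)) + w (2 + j)) ≡⟨ cong (λ i → w (2 + p + (2 + p + j)) + w j + (w (p + i) + w (2 + j))) (idx₃ p j) ⟩
    w (2 + p + (2 + p + j)) + w j + (w (p + (p + (2 + j))) + w (2 + j)) ≡⟨ cong (w (2 + p + (2 + p + j)) + w j +_) (Λ-* w rec p (2 + j)) ⟨
    w (2 + p + (2 + p + j)) + w j + Λ p * w (p + (2 + j)) ≡⟨ cong (λ i → w (2 + p + (2 + p + j)) + w j + Λ p * w i) (idx₃ p j) ⟨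
    w (2 + p + (2 + p + j)) + w j + Λ p * X            ∎)
    where
    open ≡-Reasoning
    X = w (2 + p + j)
    swap : ∀ a b c d → a + b + (c + d) ≡ a + d + (b + c)
    swap = solve-∀
    idx₁ : ∀ p j → 2 + p + j ≡ 1 + p + (1 + j)
    idx₁ = solve-∀
    idx₂ : ∀ p j → 1 + p + (1 + p + (1 + j)) ≡ 1 + (p + (2 + p + j))
    idx₂ = solve-∀
    idx₃ : ∀ p j → 2 + p + j ≡ p + (2 + j)
    idx₃ = solve-∀

  -- `E W` starts at index -W of the extended sequence; raising the offset by p makes room for the
  -- shift by -p.
  Λ-E : ∀ p W j → ∃ λ i → ∃ λ k → Λ p * E W j ≡ F i + F k
  Λ-E p W j with E-Fib (p + W) (p + (p + j)) | E-Fib (p + W) j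
  ... | i , eqi | k , eqk = i , k , (begin
    Λ p * E W j                       ≡⟨ cong (Λ p *_) (E-shift p W j) ⟨
    Λ p * E (p + W) (p + j)           ≡⟨ Λ-* (E (p + W)) (E-rec (p + W)) p j ⟩
    E (p + W) (p + (p + j)) + E (p + W) j ≡⟨ cong₂ _+_ eqi eqk ⟩
    F i + F k ∎)
    where open ≡-Reasoning

  -- Digit sums of multiples of Fibonacci numbers

  sF-F+F+ : ∀ i k n → sF (F i + F k + n) ≤ 2 + sF n
  sF-F+F+ i k n = begin
    sF (F i + F k + n)         ≤⟨ sF-+ (F i + F k) n ⟩
    sF (F i + F k) + sF n      ≤⟨ +-monoˡ-≤ (sF n) (sF-+F (F i) k) ⟩
    suc (sF (F i)) + sF n      ≤⟨ +-monoˡ-≤ (sF n) (s≤s (sF-F i)) ⟩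
    2 + sF n                   ∎
    where open ≤-Reasoning

  Λ<Λ-suc : ∀ p → Λ p < Λ (suc p)
  Λ<Λ-suc zero = ≤-refl
  Λ<Λ-suc (suc p) = +-cancelʳ-< (Λ p) _ _ (begin-strict
    Λ (1 + p) + Λ p             <⟨ +-monoʳ-< (Λ (1 + p)) (Λ<Λ-suc p) ⟩
    Λ (1 + p) + Λ (1 + p)       ≤⟨ +-monoʳ-≤ (Λ (1 + p)) (m≤m+n _ (1 * Λ (1 + p))) ⟩
    3 * Λ (1 + p)               ≡⟨ Λ-rec p ⟨
    Λ (2 + p) + Λ p             ∎)
    where open ≤-Reasoning

  -- Greedy expansion of t in the Lucas numbers Λ p, with digits at most 2. After a digit 2 the
  -- remainder satisfies the stronger bound, so that the digits are 1 on average.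
  mutual
    sF-*E : ∀ p t W j → t < Λ (suc p) → sF (t * E W j) ≤ 2 * suc p
    sF-*E zero 0 W j _ = z≤n
    sF-*E zero 1 W j _ with E-Fib W j
    ... | i , eq rewrite *-identityˡ (E W j) | eq = ≤-trans (sF-F i) (s≤s z≤n)
    sF-*E zero 2 W j _ with Λ-E 0 W j
    ... | i , k , eq rewrite eq = ≤-trans (sF-+F (F i) k) (s≤s (sF-F i))
    sF-*E zero (suc (suc (suc t))) W j (s≤s (s≤s (s≤s ())))
    sF-*E (suc p) t W j t< with t <? Λ (suc p)
    ... | yes small = ≤-trans (sF-*E p t W j small) (*-monoʳ-≤ 2 (n≤1+n (suc p)))
    ... | no big with m≤n⇒∃[o]m+o≡n (≮⇒≥ big)
    ...   | r , refl with r <? Λ (suc p)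
    ...     | yes r< = ≤-trans (sF-Λ+ (suc p) r W j) (≤-trans (+-monoʳ-≤ 2 (sF-*E p r W j r<)) (≤-reflexive (sym (*-suc 2 (suc p)))))
    ...     | no big' with m≤n⇒∃[o]m+o≡n (≮⇒≥ big')
    ...       | s , refl = begin
      sF ((Λ (suc p) + (Λ (suc p) + s)) * E W j)  ≤⟨ sF-Λ+ (suc p) _ W j ⟩
      2 + sF ((Λ (suc p) + s) * E W j)            ≤⟨ +-monoʳ-≤ 2 (sF-Λ+ (suc p) s W j) ⟩
      4 + sF (s * E W j)                          ≤⟨ +-monoʳ-≤ 4 (sF-*E′ p s W j s<) ⟩
      4 + 2 * p                                   ≡⟨ lem p ⟩
      2 * suc (suc p)                             ∎
      where
      open ≤-Reasoning
      lem : ∀ p → 4 + 2 * p ≡ 2 * suc (suc p)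
      lem = solve-∀
      swap : ∀ L s M → s + M + (L + L) ≡ L + (L + s) + M
      swap = solve-∀
      three : ∀ L → 3 * L ≡ L + (L + L)
      three = solve-∀
      -- As Λ (2 + p) = 3 Λ (1 + p) - Λ p, removing two copies of Λ (1 + p) leaves less than Λ (1 +
      -- p) - Λ p.
      s< : s + Λ p < Λ (suc p)
      s< = +-cancelʳ-< (Λ (suc p) + Λ (suc p)) _ _ (subst₂ _<_ (sym (swap (Λ (suc p)) s (Λ p))) (trans (Λ-rec p) (three (Λ (suc p)))) (+-monoˡ-< (Λ p) t<))

    sF-*E′ : ∀ p t W j → t + Λ p < Λ (suc p) → sF (t * E W j) ≤ 2 * p
    sF-*E′ zero zero W j _ = z≤n
    sF-*E′ zero (suc t) W j (s≤s t<) = contradiction (≤-trans (m≤n+m 2 t) (≤-pred t<)) λ { (s≤s ()) }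
    sF-*E′ (suc p) t W j t< with t <? Λ (suc p)
    ... | yes small = sF-*E p t W j small
    ... | no big with m≤n⇒∃[o]m+o≡n (≮⇒≥ big)
    ...   | r , refl = begin
      sF ((Λ (suc p) + r) * E W j)                ≤⟨ sF-Λ+ (suc p) r W j ⟩
      2 + sF (r * E W j)                          ≤⟨ +-monoʳ-≤ 2 (sF-*E′ p r W j r<) ⟩
      2 + 2 * p                                   ≡⟨ *-suc 2 p ⟨
      2 * suc p                                   ∎
      where
      open ≤-Reasoning
      swap : ∀ L r M → r + M + (L + L) ≡ L + r + L + M
      swap = solve-∀
      three : ∀ L → 3 * L ≡ L + (L + L)
      three = solve-∀
      r< : r + Λ p < Λ (suc p)
      r< = +-cancelʳ-< (Λ (suc p) + Λ (suc p)) _ _ (subst₂ _<_ (sym (swap (Λ (suc p)) r (Λ p))) (trans (Λ-rec p) (three (Λ (suc p)))) (+-monoˡ-< (Λ p) t<))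

    sF-Λ+ : ∀ p r W j → sF ((Λ p + r) * E W j) ≤ 2 + sF (r * E W j)
    sF-Λ+ p r W j with Λ-E p W j
    ... | i , k , eq rewrite *-distribʳ-+ (E W j) (Λ p) r | eq = sF-F+F+ i k _

  -- Polynomials as coefficient lists, and the square and cube of T

  infixl 6 _⊕_
  infixl 7 _⊛_

  _⊕_ : List ℕ → List ℕ → List ℕ
  [] ⊕ g = g
  (x ∷ f) ⊕ [] = x ∷ f
  (x ∷ f) ⊕ (y ∷ g) = x + y ∷ f ⊕ g

  _⊛_ : List ℕ → List ℕ → List ℕ
  [] ⊛ g = []
  (x ∷ f) ⊛ g = map (x *_) g ⊕ (0 ∷ f ⊛ g)

  infixr 5 _∷≡_

  -- Splits an identity of polynomials into one ring identity per coefficient.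
  _∷≡_ : ∀ {x y : ℕ} {f g : List ℕ} → x ≡ y → f ≡ g → x ∷ f ≡ y ∷ g
  refl ∷≡ refl = refl

  sum-⊕ : ∀ f g → sum (f ⊕ g) ≡ sum f + sum g
  sum-⊕ [] g = refl
  sum-⊕ (x ∷ f) [] = sym (+-identityʳ _)
  sum-⊕ (x ∷ f) (y ∷ g) = trans (cong (x + y +_) (sum-⊕ f g)) (swap x y (sum f) (sum g))
    where
    swap : ∀ x y s t → x + y + (s + t) ≡ x + s + (y + t)
    swap = solve-∀

  sum-map-* : ∀ x f → sum (map (x *_) f) ≡ x * sum f
  sum-map-* x [] = sym (*-zeroʳ x)
  sum-map-* x (y ∷ f) = trans (cong (x * y +_) (sum-map-* x f)) (sym (*-distribˡ-+ x y (sum f)))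

  sum-⊛ : ∀ f g → sum (f ⊛ g) ≡ sum f * sum g
  sum-⊛ [] g = refl
  sum-⊛ (x ∷ f) g = begin
    sum (map (x *_) g ⊕ (0 ∷ f ⊛ g))     ≡⟨ sum-⊕ (map (x *_) g) _ ⟩
    sum (map (x *_) g) + sum (f ⊛ g)     ≡⟨ cong₂ _+_ (sum-map-* x g) (sum-⊛ f g) ⟩
    x * sum g + sum f * sum g            ≡⟨ *-distribʳ-+ (sum g) x (sum f) ⟨
    (x + sum f) * sum g                  ∎
    where open ≡-Reasoning

  length-⊕ : ∀ f g {n} → length f ≤ n → length g ≤ n → length (f ⊕ g) ≤ n
  length-⊕ [] g _ q = q
  length-⊕ (x ∷ f) [] p _ = p
  length-⊕ (x ∷ f) (y ∷ g) (s≤s p) (s≤s q) = s≤s (length-⊕ f g p q)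

  length-⊛ : ∀ f g {l} → length g ≤ suc l → length (f ⊛ g) ≤ length f + l
  length-⊛ [] g _ = z≤n
  length-⊛ (x ∷ f) g {l} q = length-⊕ (map (x *_) g) _
    (≤-trans (≤-reflexive (length-map (x *_) g)) (≤-trans q (s≤s (m≤n+m l (length f)))))
    (s≤s (length-⊛ f g q))

  -- For b = 3 + c, the Laurent polynomial T = 2x² + bx − 1 + bx⁻¹ + 2x⁻² has a negative coefficient,
  -- but T² and T³ have none. These are the coefficient lists of T + 1, T² and T³.
  T+1 T² T³ : ℕ → List ℕ
  T+1 c = 2 ∷ 3 + c ∷ 0 ∷ 3 + c ∷ 2 ∷ []
  T² c = 4 ∷ 4 * (3 + c) ∷ (1 + c) * (5 + c) ∷ 2 * (3 + c) ∷ 9 + 2 * ((3 + c) * (3 + c))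
    ∷ 2 * (3 + c) ∷ (1 + c) * (5 + c) ∷ 4 * (3 + c) ∷ 4 ∷ []
  T³ c = 8 ∷ 12 * (3 + c) ∷ 42 + 36 * c + 6 * (c * c) ∷ ((3 + c) * (3 + c) * (3 + c))
    ∷ 30 + 9 * ((3 + c) * (3 + c)) ∷ 3 * ((3 + c) * (3 + c) * (3 + c)) + 15 * (3 + c) ∷ 29 + 36 * c + 6 * (c * c)
    ∷ 3 * ((3 + c) * (3 + c) * (3 + c)) + 15 * (3 + c) ∷ 30 + 9 * ((3 + c) * (3 + c))
    ∷ ((3 + c) * (3 + c) * (3 + c)) ∷ 42 + 36 * c + 6 * (c * c) ∷ 12 * (3 + c) ∷ 8 ∷ []

  -- Squaring and cubing T = (T + 1) − 1, with all negative terms moved to the other side: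
  -- (T + 1)² + 1 = T² + 2(T + 1) and (T + 1)³ + 3(T + 1) = T³ + 3(T + 1)² + 1.
  T²-eq : ∀ c → T+1 c ⊛ T+1 c ⊕ (0 ∷ 0 ∷ 0 ∷ 0 ∷ 1 ∷ []) ≡ T² c ⊕ (0 ∷ 0 ∷ map (2 *_) (T+1 c))
  T²-eq c = refl ∷≡ solve (c ∷ []) ∷≡ solve (c ∷ []) ∷≡ solve (c ∷ []) ∷≡ solve (c ∷ [])
    ∷≡ solve (c ∷ []) ∷≡ solve (c ∷ []) ∷≡ solve (c ∷ []) ∷≡ solve (c ∷ []) ∷≡ refl

  T³-eq : ∀ c → T+1 c ⊛ (T+1 c ⊛ T+1 c) ⊕ (0 ∷ 0 ∷ 0 ∷ 0 ∷ map (3 *_) (T+1 c))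
    ≡ T³ c ⊕ (0 ∷ 0 ∷ map (3 *_) (T+1 c ⊛ T+1 c) ⊕ (0 ∷ 0 ∷ 0 ∷ 0 ∷ 1 ∷ []))
  T³-eq c = refl ∷≡ solve (c ∷ []) ∷≡ solve (c ∷ []) ∷≡ solve (c ∷ []) ∷≡ solve (c ∷ [])
    ∷≡ solve (c ∷ []) ∷≡ solve (c ∷ []) ∷≡ solve (c ∷ []) ∷≡ solve (c ∷ []) ∷≡ solve (c ∷ [])
    ∷≡ solve (c ∷ []) ∷≡ solve (c ∷ []) ∷≡ solve (c ∷ []) ∷≡ refl

  sum-T² : ∀ c → sum (T² c) ≡ (9 + 2 * c) * (9 + 2 * c)
  sum-T² c = lem c
    where
    lem : ∀ c → 4 + (4 * (3 + c) + ((1 + c) * (5 + c) + (2 * (3 + c) + (9 + 2 * ((3 + c) * (3 + c))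
      + (2 * (3 + c) + ((1 + c) * (5 + c) + (4 * (3 + c) + (4 + 0)))))))) ≡ (9 + 2 * c) * (9 + 2 * c)
    lem = solve-∀

  sum-T³ : ∀ c → sum (T³ c) ≡ (9 + 2 * c) * ((9 + 2 * c) * (9 + 2 * c))
  sum-T³ c = lem c
    where
    lem : ∀ c → 8 + (12 * (3 + c) + (42 + 36 * c + 6 * (c * c) + ((3 + c) * (3 + c) * (3 + c)
      + (30 + 9 * ((3 + c) * (3 + c)) + (3 * ((3 + c) * (3 + c) * (3 + c)) + 15 * (3 + c) + (29 + 36 * c + 6 * (c * c)
      + (3 * ((3 + c) * (3 + c) * (3 + c)) + 15 * (3 + c) + (30 + 9 * ((3 + c) * (3 + c))
      + ((3 + c) * (3 + c) * (3 + c) + (42 + 36 * c + 6 * (c * c) + (12 * (3 + c) + (8 + 0))))))))))))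
      ≡ (9 + 2 * c) * ((9 + 2 * c) * (9 + 2 * c))
    lem = solve-∀

  -- Laurent polynomials acting on a sequence by shifts

  module Evaluation (H : ℕ → ℕ) where

    ev : ℕ → List ℕ → ℕ
    ev i [] = 0
    ev i (c ∷ f) = c * H i + ev (suc i) f

    -- f is the coefficient list, with constant term at position d, of a Laurent polynomial acting on H
    -- (through shifts) as multiplication by x.
    record Acts (x d : ℕ) (f : List ℕ) : Set where
      constructor acting
      field act : ∀ i → x * H (d + i) ≡ ev i f
    open Acts

    ev-⊕ : ∀ i f g → ev i (f ⊕ g) ≡ ev i f + ev i g
    ev-⊕ i [] g = refl
    ev-⊕ i (x ∷ f) [] = sym (+-identityʳ _)
    ev-⊕ i (x ∷ f) (y ∷ g) = trans (cong ((x + y) * H i +_) (ev-⊕ (suc i) f g)) (swap x y (H i) (ev (suc i) f) (ev (suc i) g))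
      where
      swap : ∀ x y h s t → (x + y) * h + (s + t) ≡ x * h + s + (y * h + t)
      swap = solve-∀

    ev-map-* : ∀ x i f → ev i (map (x *_) f) ≡ x * ev i f
    ev-map-* x i [] = sym (*-zeroʳ x)
    ev-map-* x i (y ∷ f) = trans (cong (x * y * H i +_) (ev-map-* x (suc i) f)) (dist x y (H i) (ev (suc i) f))
      where
      dist : ∀ x y h s → x * y * h + x * s ≡ x * (y * h + s)
      dist = solve-∀

    ev-⊛ : ∀ {y d} f g → Acts y d g → ∀ i → ev i (f ⊛ g) ≡ y * ev (d + i) f
    ev-⊛ {y} [] g G i = sym (*-zeroʳ y)
    ev-⊛ {y} {d} (x ∷ f) g G i = begin
      ev i (map (x *_) g ⊕ (0 ∷ f ⊛ g))         ≡⟨ ev-⊕ i (map (x *_) g) _ ⟩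
      ev i (map (x *_) g) + ev (suc i) (f ⊛ g)  ≡⟨ cong₂ _+_ (trans (ev-map-* x i g) (cong (x *_) (sym (act G i)))) (ev-⊛ f g G (suc i)) ⟩
      x * (y * H (d + i)) + y * ev (d + suc i) f ≡⟨ cong (λ j → x * (y * H (d + i)) + y * ev j f) (+-suc d i) ⟩
      x * (y * H (d + i)) + y * ev (suc d + i) f ≡⟨ dist x y (H (d + i)) _ ⟩
      y * ev (d + i) (x ∷ f) ∎
      where
      open ≡-Reasoning
      dist : ∀ x y h s → x * (y * h) + y * s ≡ y * (x * h + s)
      dist = solve-∀

    Acts-1 : Acts 1 0 (1 ∷ [])
    Acts-1 = acting λ i → sym (+-identityʳ _)

    Acts-⊛ : ∀ {x y d d'} f g → Acts x d f → Acts y d' g → Acts (x * y) (d + d') (f ⊛ g)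
    Acts-⊛ {x} {y} {d} {d'} f g A G = acting λ i → begin
      x * y * H (d + d' + i)    ≡⟨ cong₂ _*_ (*-comm x y) (cong H (+-assoc d d' i)) ⟩
      y * x * H (d + (d' + i))  ≡⟨ *-assoc y x _ ⟩
      y * (x * H (d + (d' + i))) ≡⟨ cong (y *_) (act A (d' + i)) ⟩
      y * ev (d' + i) f         ≡⟨ ev-⊛ f g G i ⟨
      ev i (f ⊛ g)              ∎
      where open ≡-Reasoning

    Acts-⊕ : ∀ {x y d} f g → Acts x d f → Acts y d g → Acts (x + y) d (f ⊕ g)
    Acts-⊕ {x} {y} f g A G = acting λ i → trans (*-distribʳ-+ _ x y) (trans (cong₂ _+_ (act A i) (act G i)) (sym (ev-⊕ i f g)))

    Acts-map-* : ∀ {x d} k f → Acts x d f → Acts (k * x) d (map (k *_) f)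
    Acts-map-* {x} k f A = acting λ i → trans (*-assoc k x _) (trans (cong (k *_) (act A i)) (sym (ev-map-* k i f)))

    Acts-∷ : ∀ {x d} f → Acts x d f → Acts x (suc d) (0 ∷ f)
    Acts-∷ {x} {d} f A = acting λ i → trans (cong (λ j → x * H j) (sym (+-suc d i))) (act A (suc i))

    -- Subtraction without negative numbers: applied to `T²-eq` and `T³-eq` it isolates the actions
    -- of n² and n³, although T has a negative coefficient.
    Acts-⊕-cancel : ∀ {x y d} f g → Acts (x + y) d (f ⊕ g) → Acts y d g → Acts x d f
    Acts-⊕-cancel {x} {y} f g A G = acting λ i → +-cancelʳ-≡ (ev i g) _ _
      (trans (cong (x * _ +_) (sym (act G i))) (trans (sym (*-distribʳ-+ _ x y)) (trans (act A i) (ev-⊕ i f g))))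

    module Powers {n c : ℕ} (base : Acts (1 + n) 2 (T+1 c)) where

      sq : Acts ((1 + n) * (1 + n)) 4 (T+1 c ⊛ T+1 c)
      sq = Acts-⊛ (T+1 c) (T+1 c) base base

      Acts-T² : Acts (n * n) 4 (T² c)
      Acts-T² = Acts-⊕-cancel (T² c) _
        (subst₂ (λ x f → Acts x 4 f) (lem n) (T²-eq c) (Acts-⊕ (T+1 c ⊛ T+1 c) _ sq (Acts-∷ _ (Acts-∷ _ (Acts-∷ _ (Acts-∷ _ Acts-1))))))
        (Acts-∷ _ (Acts-∷ _ (Acts-map-* 2 (T+1 c) base)))
        where
        lem : ∀ n → (1 + n) * (1 + n) + 1 ≡ n * n + 2 * (1 + n)
        lem = solve-∀

      Acts-T³ : Acts (n * (n * n)) 6 (T³ c)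
      Acts-T³ = Acts-⊕-cancel (T³ c) _
        (subst₂ (λ x f → Acts x 6 f) (lem n) (T³-eq c)
          (Acts-⊕ (T+1 c ⊛ (T+1 c ⊛ T+1 c)) _ (Acts-⊛ (T+1 c) (T+1 c ⊛ T+1 c) base sq)
            (Acts-∷ _ (Acts-∷ _ (Acts-∷ _ (Acts-∷ _ (Acts-map-* 3 (T+1 c) base)))))))
        (Acts-∷ _ (Acts-∷ _ (Acts-⊕ (map (3 *_) (T+1 c ⊛ T+1 c)) _ (Acts-map-* 3 (T+1 c ⊛ T+1 c) sq)
          (Acts-∷ _ (Acts-∷ _ (Acts-∷ _ (Acts-∷ _ Acts-1)))))))
        where
        lem : ∀ n → (1 + n) * ((1 + n) * (1 + n)) + 3 * (1 + n) ≡ n * (n * n) + (3 * ((1 + n) * (1 + n)) + 1)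
        lem = solve-∀

      -- `sum≡` is the value T(1)^h, where T(1) = 2b + 3 = 9 + 2c; as no coefficient is negative, it
      -- bounds each of them.
      record Power (h : ℕ) : Set where
        field
          coeffs : List ℕ
          length≤ : length coeffs ≤ 1 + 4 * h
          sum≡ : sum coeffs ≡ (9 + 2 * c) ^ h
          acts : Acts (n ^ h) (2 * h) coeffs

      power-0 : Power 0
      power-0 = record { coeffs = 1 ∷ [] ; length≤ = ≤-refl ; sum≡ = refl ; acts = Acts-1 }

      power-+ : ∀ {k h} g → length g ≤ suc (4 * k) → sum g ≡ (9 + 2 * c) ^ k → Acts (n ^ k) (2 * k) g → Power h → Power (k + h)
      power-+ {k} {h} g l s A P = record
        { coeffs = coeffs ⊛ g
        ; length≤ = ≤-trans (length-⊛ coeffs g l) (≤-trans (+-monoˡ-≤ (4 * k) length≤) (≤-reflexive (lem₁ k h)))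
        ; sum≡ = trans (sum-⊛ coeffs g) (trans (cong₂ _*_ sum≡ s) (trans (sym (^-distribˡ-+-* B h k)) (cong (B ^_) (+-comm h k))))
        ; acts = subst₂ (λ x d → Acts x d (coeffs ⊛ g))
            (trans (sym (^-distribˡ-+-* n h k)) (cong (n ^_) (+-comm h k))) (lem₂ k h) (Acts-⊛ coeffs g acts A)
        }
        where
        open Power P
        B = 9 + 2 * c
        lem₁ : ∀ k h → 1 + 4 * h + 4 * k ≡ 1 + 4 * (k + h)
        lem₁ = solve-∀
        lem₂ : ∀ k h → 2 * h + 2 * k ≡ 2 * (k + h)
        lem₂ = solve-∀

      square : ∀ {h} → Power h → Power (2 + h)
      square = power-+ (T² c) ≤-refl (trans (sum-T² c) (cong (B *_) (sym (*-identityʳ B))))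
        (subst (λ x → Acts x 4 (T² c)) (cong (n *_) (sym (*-identityʳ n))) Acts-T²)
        where B = 9 + 2 * c

      cube : ∀ {h} → Power h → Power (3 + h)
      cube = power-+ (T³ c) ≤-refl (trans (sum-T³ c) (cong (λ x → B * (B * x)) (sym (*-identityʳ B))))
        (subst (λ x → Acts x 6 (T³ c)) (cong (λ x → n * (n * x)) (sym (*-identityʳ n))) Acts-T³)
        where B = 9 + 2 * c

      -- Every exponent from 2 on is a sum of twos and at most one three.
      power : ∀ h → Power (2 + h)
      power 0 = square power-0
      power 1 = cube power-0
      power (suc (suc h)) = square (power h)

  -- Growth of the Lucas numbers of even index

  Λ-+ : ∀ p d → Λ p ≤ Λ (d + p)
  Λ-+ p zero = ≤-refl
  Λ-+ p (suc d) = ≤-trans (Λ-+ p d) (<⇒≤ (Λ<Λ-suc (d + p)))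

  Λ-mono : ∀ {p q} → p ≤ q → Λ p ≤ Λ q
  Λ-mono {p} {q} p≤q = subst (λ k → Λ p ≤ Λ k) (m∸n+n≡m p≤q) (Λ-+ p (q ∸ p))

  Λ> : ∀ p → p < Λ p
  Λ> zero = s≤s z≤n
  Λ> (suc p) = ≤-trans (s≤s (Λ> p)) (Λ<Λ-suc p)

  Λ-double : ∀ p → 2 * Λ (1 + p) < Λ (2 + p)
  Λ-double p = +-cancelʳ-< (Λ p) _ _ (begin-strict
    2 * Λ (1 + p) + Λ p          <⟨ +-monoʳ-< (2 * Λ (1 + p)) (Λ<Λ-suc p) ⟩
    2 * Λ (1 + p) + Λ (1 + p)    ≡⟨ +-comm (2 * Λ (1 + p)) _ ⟩
    3 * Λ (1 + p)                ≡⟨ Λ-rec p ⟨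
    Λ (2 + p) + Λ p              ∎)
    where open ≤-Reasoning

  Λ-triple : ∀ p → Λ (suc p) ≤ 3 * Λ p
  Λ-triple zero = s≤s (s≤s (s≤s z≤n))
  Λ-triple (suc p) = ≤-trans (m≤m+n _ (Λ p)) (≤-reflexive (Λ-rec p))

  Λ-+≤ : ∀ r p → Λ (r + p) ≤ 3 ^ r * Λ p
  Λ-+≤ zero p = ≤-reflexive (sym (*-identityˡ _))
  Λ-+≤ (suc r) p = ≤-trans (Λ-triple (r + p))
    (≤-trans (*-monoʳ-≤ 3 (Λ-+≤ r p)) (≤-reflexive (sym (*-assoc 3 (3 ^ r) (Λ p)))))

  Λ-*≤Λ^ : ∀ r m → Λ (suc r * m) ≤ Λ m ^ suc r
  Λ-*≤Λ^ zero m = ≤-reflexive (trans (cong Λ (*-identityˡ m)) (sym (*-identityʳ (Λ m))))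
  Λ-*≤Λ^ (suc r) m = begin
    Λ (m + (m + r * m))                ≤⟨ m≤m+n _ (Λ (r * m)) ⟩
    Λ (m + (m + r * m)) + Λ (r * m)    ≡⟨ Λ-* Λ Λ-rec m (r * m) ⟨
    Λ m * Λ (m + r * m)                ≤⟨ *-monoʳ-≤ (Λ m) (Λ-*≤Λ^ r m) ⟩
    Λ m ^ suc (suc r)                  ∎
    where open ≤-Reasoning

  -- By `Λ-*` each further factor costs at most a factor 2 beyond the shift by m, and `Λ-double`
  -- pays for it with one more index; hence `suc m`.
  Λ^≤Λ-* : ∀ r m → Λ m ^ r ≤ Λ (r * suc m)
  Λ^≤Λ-* zero m = s≤s z≤n
  Λ^≤Λ-* (suc zero) m = begin
    Λ m * 1             ≡⟨ *-identityʳ (Λ m) ⟩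
    Λ m                 ≤⟨ <⇒≤ (Λ<Λ-suc m) ⟩
    Λ (suc m)           ≡⟨ cong Λ (*-identityˡ (suc m)) ⟨
    Λ (1 * suc m)       ∎
    where open ≤-Reasoning
  Λ^≤Λ-* (suc (suc r)) m = begin
    Λ m * Λ m ^ suc r                    ≤⟨ *-monoʳ-≤ (Λ m) (Λ^≤Λ-* (suc r) m) ⟩
    Λ m * Λ (suc m + r * suc m)          ≡⟨ cong (λ x → Λ m * Λ x) (+-suc m c) ⟨
    Λ m * Λ (m + suc c)                  ≡⟨ Λ-* Λ Λ-rec m (suc c) ⟩
    Λ (m + (m + suc c)) + Λ (suc c)      ≤⟨ +-monoʳ-≤ (Λ (m + (m + suc c))) (Λ-mono (≤-trans (m≤n+m (suc c) m) (m≤n+m _ m))) ⟩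
    Λ (m + (m + suc c)) + Λ (m + (m + suc c)) ≡⟨ cong (λ x → Λ x + Λ x) (idx m c) ⟩
    Λ (1 + (m + (m + c))) + Λ (1 + (m + (m + c))) ≡⟨ cong (Λ (1 + (m + (m + c))) +_) (+-identityʳ _) ⟨
    2 * Λ (1 + (m + (m + c)))            ≤⟨ <⇒≤ (Λ-double (m + (m + c))) ⟩
    Λ (2 + (m + (m + c)))                ≡⟨ cong (λ x → Λ (1 + x)) (+-suc m (m + c)) ⟨
    Λ (suc m + (suc m + c))              ∎
    where
    open ≤-Reasoning
    c = r * suc m
    idx : ∀ m c → m + (m + suc c) ≡ 1 + (m + (m + c))
    idx = solve-∀

  -- Upper bound for the digit sum of n^h

  module PowerDigits {κ n c : ℕ} (n-def : 1 + n ≡ 2 * Λ (κ + κ) + (3 + c) * Λ κ) where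

    -- Sampling at multiples of κ makes the unit shift play the role of x = φ^{2κ}.
    H : ℕ → ℕ → ℕ
    H W j = E W (κ * j)

    base : ∀ W → Evaluation.Acts (H W) (1 + n) 2 (T+1 c)
    base W = Evaluation.acting λ i → begin
      (1 + n) * H W (2 + i)                                  ≡⟨ cong (_* H W (2 + i)) n-def ⟩
      (2 * Λ (κ + κ) + (3 + c) * Λ κ) * H W (2 + i)          ≡⟨ expand (Λ (κ + κ)) (3 + c) (Λ κ) (H W (2 + i)) ⟩
      2 * (Λ (κ + κ) * H W (2 + i)) + (3 + c) * (Λ κ * H W (2 + i)) ≡⟨ cong₂ (λ x y → 2 * x + (3 + c) * y) (outer i) (inner i) ⟩
      2 * (H W (4 + i) + H W i) + (3 + c) * (H W (3 + i) + H W (1 + i)) ≡⟨ collect (H W i) (H W (1 + i)) (H W (2 + i)) (H W (3 + i)) (H W (4 + i)) c ⟩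
      Evaluation.ev (H W) i (T+1 c) ∎
      where
      open ≡-Reasoning
      expand : ∀ x b y h → (2 * x + b * y) * h ≡ 2 * (x * h) + b * (y * h)
      expand = solve-∀
      collect : ∀ h₀ h₁ h₂ h₃ h₄ c → 2 * (h₄ + h₀) + (3 + c) * (h₃ + h₁)
        ≡ 2 * h₀ + ((3 + c) * h₁ + (0 + ((3 + c) * h₃ + (2 * h₄ + 0))))
      collect = solve-∀
      inner : ∀ i → Λ κ * H W (2 + i) ≡ H W (3 + i) + H W (1 + i)
      inner i rewrite *-suc κ (2 + i) | *-suc κ (1 + i) = Λ-* (E W) (E-rec W) κ (κ * (1 + i))
      outer : ∀ i → Λ (κ + κ) * H W (2 + i) ≡ H W (4 + i) + H W i
      outer i = begin
        Λ (κ + κ) * E W (κ * (2 + i)) ≡⟨ cong (λ j → Λ (κ + κ) * E W j) (idx κ i) ⟩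
        Λ (κ + κ) * E W (κ + κ + κ * i) ≡⟨ Λ-* (E W) (E-rec W) (κ + κ) (κ * i) ⟩
        E W (κ + κ + (κ + κ + κ * i)) + E W (κ * i) ≡⟨ cong (λ j → E W j + E W (κ * i)) (idx' κ i) ⟨
        H W (4 + i) + H W i ∎
        where
        idx : ∀ κ i → κ * (2 + i) ≡ κ + κ + κ * i
        idx = solve-∀
        idx' : ∀ κ i → κ * (4 + i) ≡ κ + κ + (κ + κ + κ * i)
        idx' = solve-∀

    sF-ev : ∀ W p f → sum f < Λ (suc p) → ∀ i → sF (Evaluation.ev (H W) i f) ≤ length f * (2 * suc p)
    sF-ev W p [] _ i = z≤n
    sF-ev W p (x ∷ f) s< i = ≤-trans (sF-+ (x * H W i) _)
      (+-mono-≤ (sF-*E p x W (κ * i) (≤-<-trans (m≤m+n x (sum f)) s<))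
                (sF-ev W p f (≤-<-trans (m≤n+m (sum f) x) s<) (suc i)))

    sF-^ : ∀ {m} → 9 + 2 * c ≤ Λ (suc m) → ∀ h → let h' = 2 + h in
      sF (n ^ h') ≤ (1 + 4 * h') * (2 * suc (h' * (2 + m)))
    sF-^ {m} B≤ h = begin
      sF (n ^ h')               ≡⟨ cong sF n^h≡ ⟩
      sF (ev 0 coeffs)          ≤⟨ sF-ev W (h' * (2 + m)) coeffs sum< 0 ⟩
      length coeffs * (2 * suc (h' * (2 + m))) ≤⟨ *-monoˡ-≤ (2 * suc (h' * (2 + m))) length≤ ⟩
      (1 + 4 * h') * (2 * suc (h' * (2 + m))) ∎
      where
      open ≤-Reasoning
      h' = 2 + h
      -- The offset puts position 2h' of the list, that of the constant term, at e 0 = 1; the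
      -- positions before it fall on negative indices.
      W = κ * (2 * h')
      open Evaluation (H W)
      open Powers (base W)
      open Power (power h)
      sum< : sum coeffs < Λ (suc (h' * (2 + m)))
      sum< = begin-strict
        sum coeffs           ≡⟨ sum≡ ⟩
        (9 + 2 * c) ^ h'     ≤⟨ ^-monoˡ-≤ h' B≤ ⟩
        Λ (suc m) ^ h'       ≤⟨ Λ^≤Λ-* h' (suc m) ⟩
        Λ (h' * (2 + m))     <⟨ Λ<Λ-suc (h' * (2 + m)) ⟩
        Λ (suc (h' * (2 + m))) ∎
      n^h≡ : n ^ h' ≡ ev 0 coeffs
      n^h≡ = begin-equality
        n ^ h'                      ≡⟨ *-identityʳ (n ^ h') ⟨
        n ^ h' * 1                  ≡⟨ cong (n ^ h' *_) (E-diagonal W) ⟨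
        n ^ h' * H W (2 * h')       ≡⟨ cong (λ j → n ^ h' * H W j) (+-identityʳ (2 * h')) ⟨
        n ^ h' * H W (2 * h' + 0)   ≡⟨ Acts.act acts 0 ⟩
        ev 0 coeffs ∎

  -- Lower bound for the digit sum of n

  record Top (i r s : ℕ) : Set where
    constructor top
    field
      bound : r < F (2 * i)
      digits : s ≤ sF r

  -- Since r < F_{2j}, the term F_{2j+1} becomes the leading digit and no carry occurs.
  Top-e : ∀ {i r s} j → i ≤ j → Top i r s → Top (suc j) (e j + r) (suc s)
  Top-e zero z≤n (top () _)
  Top-e {i} {r} {s} (suc j) i≤j (top b d) = top
    (subst (λ x → e (suc j) + r < F x) (sym (*-suc 2 (suc j))) (+-monoʳ-< (e (suc j)) r<))
    (≤-trans (s≤s d) (≤-reflexive (sym (trans (cong (λ x → sF (x + r)) (e-suc j))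
      (sF-greedy (1 + 2 * j) r (subst (λ x → r < F x) (*-suc 2 j) r<))))))
    where
    r< : r < F (2 * suc j)
    r< = ≤-trans b (F-mono (*-monoʳ-≤ 2 i≤j))

  -- F_{2w+1} - 1 = F_{2w} + F_{2w-2} + ... + F_2: subtracting 1 turns one digit into w.
  e-pred : ∀ w → ∃ λ r → e w ≡ suc r × sF r ≡ w
  e-pred zero = 0 , refl , refl
  e-pred (suc w) with e-pred w
  ... | r , eq , s = F (2 + 2 * w) + r ,
    trans (e-suc w) (trans (cong (F (2 + 2 * w) +_) eq) (+-suc _ r)) ,
    trans (sF-greedy (2 * w) r (subst (r <_) (sym eq) ≤-refl)) (cong suc s)

  -- The identity 2 L_k = F_{k+3} + F_{k-3} at k = 2y + 4, which is a Zeckendorf expansion.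
  double-Λ : ∀ y → 2 * Λ (2 + y) ≡ e (3 + y) + e y
  double-Λ y = +-cancelʳ-≡ (a + b) _ _ (begin
    2 * (a + b) + (a + b)              ≡⟨ lem₁ a b ⟩
    3 * a + 3 * b                      ≡⟨ cong₂ _+_ (e-rec (1 + y)) (e-rec y) ⟨
    e (3 + y) + b + (a + e y)          ≡⟨ lem₂ (e (3 + y)) b a (e y) ⟩
    e (3 + y) + e y + (a + b)          ∎)
    where
    open ≡-Reasoning
    a = e (2 + y)
    b = e (1 + y)
    lem₁ : ∀ a b → 2 * (a + b) + (a + b) ≡ 3 * a + 3 * b
    lem₁ = solve-∀
    lem₂ : ∀ x b a z → x + b + (a + z) ≡ x + z + (a + b)
    lem₂ = solve-∀

  sF-*Λ : ∀ {m} d κ → d < Λ (suc m) → sF (d * Λ (suc κ)) ≤ 4 * suc m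
  sF-*Λ {m} d κ d< = begin
    sF (d * (e (suc κ) + e κ))          ≡⟨ cong sF (*-distribˡ-+ d (e (suc κ)) (e κ)) ⟩
    sF (d * e (suc κ) + d * e κ)        ≤⟨ sF-+ (d * e (suc κ)) _ ⟩
    sF (d * e (suc κ)) + sF (d * e κ)   ≤⟨ +-mono-≤ (sF-*E m d 0 (suc κ) d<) (sF-*E m d 0 κ d<) ⟩
    2 * suc m + 2 * suc m               ≡⟨ *-distribʳ-+ (suc m) 2 2 ⟨
    4 * suc m                           ∎
    where open ≤-Reasoning

  -- Adding d Λ κ, which has few digits, turns the coefficient b = 3 + c into Λ m, and the sum has an
  -- explicit Zeckendorf expansion ending in the roughly w digits of F_{2w+1} − 1.
  sF-lower : ∀ {n c d} m w → let κ = suc m + suc (2 + w) in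
    1 + n ≡ 2 * Λ (κ + κ) + (3 + c) * Λ κ → 3 + c + d ≡ Λ (suc m) → 7 + w ≤ sF n + 4 * suc m
  sF-lower {n} {c} {d} m w₀ n-def cd≡ = begin
    7 + w₀                       ≤⟨ Top.digits all ⟩
    sF total                     ≡⟨ cong sF total≡ ⟨
    sF (n + d * Λ κ)             ≤⟨ sF-+ n _ ⟩
    sF n + sF (d * Λ κ)          ≤⟨ +-monoʳ-≤ (sF n) (sF-*Λ {m} d (m + suc w) d<) ⟩
    sF n + 4 * suc m             ∎
    where
    open ≤-Reasoning
    -- The two extra units give y ≥ u + 2, which separates the digits of 2 Λ (2κ) from those below.
    w = 2 + w₀
    κ = suc m + suc w
    m' = suc m
    u = m' + (m' + w)
    y = (m' + w) + (m' + w)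
    r = proj₁ (e-pred w)
    d< : d < Λ (suc m)
    d< = subst (d <_) cd≡ (s≤s (m≤n+m d (2 + c)))
    -- 2 Λ (2κ) + Λ (κ + m') + Λ (κ - m') - 1, where 2κ = y + 2, κ + m' = u + 1 and κ - m' = w + 1;
    -- the final `e w` has lost 1 and become r.
    total = e (3 + y) + (e y + (e (suc u) + (e u + (e (suc w) + r))))
    t₀ : Top (suc w) r w
    t₀ = top (≤-trans (≤-reflexive (sym (proj₁ (proj₂ (e-pred w))))) (F-mono (≤-trans (n≤1+n _) (≤-reflexive (sym (*-suc 2 w))))))
             (≤-reflexive (sym (proj₂ (proj₂ (e-pred w)))))
    2+w≤u : 2 + w ≤ u
    2+w≤u = ≤-trans (≤-reflexive (+-comm 2 w)) (≤-trans (+-monoʳ-≤ w (+-mono-≤ {1} {m'} {1} {m'} (s≤s z≤n) (s≤s z≤n))) (≤-reflexive (lem m' w)))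
      where
      lem : ∀ m w → w + (m + m) ≡ m + (m + w)
      lem = solve-∀
    2+u≤y : 2 + u ≤ y
    2+u≤y = ≤-trans (+-monoˡ-≤ u (m≤m+n 2 w₀)) (≤-reflexive (lem m' w))
      where
      lem : ∀ m w → w + (m + (m + w)) ≡ m + w + (m + w)
      lem = solve-∀
    all : Top (4 + y) total (5 + w)
    all = Top-e (3 + y) (s≤s (m≤n+m y 2)) (Top-e y 2+u≤y (Top-e (suc u) ≤-refl (Top-e u 2+w≤u (Top-e (suc w) ≤-refl t₀))))
    total≡ : n + d * Λ κ ≡ total
    total≡ = suc-injective (begin-equality
      1 + n + d * Λ κ                              ≡⟨ cong (_+ d * Λ κ) n-def ⟩
      2 * Λ (κ + κ) + (3 + c) * Λ κ + d * Λ κ      ≡⟨ lem₁ (2 * Λ (κ + κ)) (3 + c) d (Λ κ) ⟩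
      2 * Λ (κ + κ) + (3 + c + d) * Λ κ            ≡⟨ cong₂ (λ x z → 2 * Λ x + z * Λ κ) (lem₂ m' w) cd≡ ⟩
      2 * Λ (2 + y) + Λ m' * Λ κ                   ≡⟨ cong₂ _+_ (double-Λ y) (Λ-* Λ Λ-rec m' (suc w)) ⟩
      e (3 + y) + e y + (Λ (m' + (m' + suc w)) + Λ (suc w)) ≡⟨ cong (λ x → e (3 + y) + e y + (Λ x + Λ (suc w))) (lem₃ m' w) ⟩
      e (3 + y) + e y + (e (suc u) + e u + (e (suc w) + e w)) ≡⟨ cong (λ x → e (3 + y) + e y + (e (suc u) + e u + (e (suc w) + x))) (proj₁ (proj₂ (e-pred w))) ⟩
      e (3 + y) + e y + (e (suc u) + e u + (e (suc w) + suc r)) ≡⟨ lem₄ (e (3 + y)) (e y) (e (suc u)) (e u) (e (suc w)) r ⟩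
      suc total ∎)
      where
      lem₁ : ∀ x b d l → x + b * l + d * l ≡ x + (b + d) * l
      lem₁ = solve-∀
      lem₂ : ∀ m w → m + suc w + (m + suc w) ≡ 2 + (m + w + (m + w))
      lem₂ = solve-∀
      lem₃ : ∀ m w → m + (m + suc w) ≡ suc (m + (m + w))
      lem₃ = solve-∀
      lem₄ : ∀ a b c d f r → a + b + (c + d + (f + suc r)) ≡ suc (a + (b + (c + (d + (f + r)))))
      lem₄ = solve-∀

  -- Counting the family

  injection⇒≤length : ∀ {A : Set} {L} {xs : List A} (f : Fin L → A) →
    (∀ {i j} → f i ≡ f j → i ≡ j) → (∀ i → f i ∈ xs) → L ≤ length xs
  injection⇒≤length {xs = xs} f inj mem = injective⇒≤ {f = λ i → index (mem i)} λ {i} {j} eq →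
    inj (trans (lookup-index (mem i)) (trans (cong (lookup xs) eq) (sym (lookup-index (mem j)))))

  ^-distribʳ-* : ∀ n x y → (x * y) ^ n ≡ x ^ n * y ^ n
  ^-distribʳ-* zero x y = refl
  ^-distribʳ-* (suc n) x y = trans (cong (x * y *_) (^-distribʳ-* n x y)) (lem x y (x ^ n) (y ^ n))
    where
    lem : ∀ x y s t → x * y * (s * t) ≡ x * s * (y * t)
    lem = solve-∀

  last-below : ∀ (g : ℕ → ℕ) {N} d → g 0 ≤ N → N < g d → ∃ λ k → g k ≤ N × N < g (suc k)
  last-below g zero lo hi = contradiction lo (<⇒≱ hi)
  last-below g {N} (suc d) lo hi with g d ≤? N
  ... | yes ≤N = d , ≤N , hi
  ... | no ≰N = last-below g d lo (≰⇒> ≰N)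

  -- Source of the 18 and so of the 36 h² in `M`. The bound fails for h' = m' = 2, so m starts at 3;
  -- the polynomial added in the proof is the exact difference.
  digit-bound : ∀ h m → let h' = 2 + h; m' = 3 + m in
    (1 + 4 * h') * (2 * suc (h' * (2 + m'))) ≤ 18 * (h' * h') * m'
  digit-bound h m = ≤-trans (m≤m+n _ (18 + 38 * h + 14 * (h * h) + m * (36 + 38 * h + 10 * (h * h)))) (≤-reflexive (lem h m))
    where
    lem : ∀ h m → (1 + 4 * (2 + h)) * (2 * (1 + (2 + h) * (2 + (3 + m)))) + (18 + 38 * h + 14 * (h * h) + m * (36 + 38 * h + 10 * (h * h)))
      ≡ 18 * ((2 + h) * (2 + h)) * (3 + m)
    lem = solve-∀

  -- ε = p / q, and the exponent is 2 + h.
  module Family (h p q Q : ℕ) (Q-def : 18 * ((2 + h) * (2 + h)) * q < suc Q * p) where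

    -- Of the κ = K m digits forced by the −1, 5 m are lost in sF-lower; the remaining (Q + 1) m suffice
    -- because Q + 1 > 18 h² q / p.
    K : ℕ
    K = 6 + Q

    -- Bounds n + 1 for all b < Λ m, so the family for m lies below N once R m ≤ N.
    R : ℕ → ℕ
    R m = 2 * Λ (K * m + K * m) + Λ m * Λ (K * m)

    module _ (m₀ : ℕ) where
      m κ L : ℕ
      m = 3 + m₀
      κ = K * m
      L = Λ m ∸ 3

      -- This is n - 1, as `count` enumerates its candidates as successors.
      member : ℕ → ℕ
      member c = 2 * Λ (κ + κ) + (3 + c) * Λ κ ∸ 2

      member-def : ∀ c → 2 + member c ≡ 2 * Λ (κ + κ) + (3 + c) * Λ κ
      member-def c = m+[n∸m]≡n (≤-trans (*-monoʳ-≤ 2 (≤-trans (s≤s z≤n) (Λ> (κ + κ)))) (m≤m+n _ _))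

      member-injective : ∀ {c d} → member c ≡ member d → c ≡ d
      member-injective {c} {d} eq = +-cancelˡ-≡ 3 c d
        (*-cancelʳ-≡ (3 + c) (3 + d) (Λ κ) {{>-nonZero (≤-trans (s≤s z≤n) (Λ> κ))}}
          (+-cancelˡ-≡ (2 * Λ (κ + κ)) _ _ (trans (sym (member-def c)) (trans (cong (2 +_) eq) (member-def d)))))

      6≤Λ : 6 ≤ Λ m
      6≤Λ = ≤-trans (m≤m+n 6 12) (Λ-mono {3} {m} (m≤m+n 3 m₀))

      b<Λ : ∀ {c} → c < L → 3 + c < Λ m
      b<Λ {c} c< = ≤-trans (≤-reflexive (sym (+-suc 3 c))) (≤-trans (+-monoʳ-≤ 3 c<) (≤-reflexive (m+[n∸m]≡n (≤-trans (m≤m+n 3 3) 6≤Λ))))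

      member< : ∀ {c N} → c < L → R m ≤ N → 1 + member c < N
      member< {c} c< R≤ = ≤-trans (≤-reflexive (member-def c))
        (≤-trans (+-monoʳ-≤ (2 * Λ (κ + κ)) (*-monoˡ-≤ (Λ κ) (<⇒≤ (b<Λ c<)))) R≤)

      ratio : ∀ {c} → c < L → let n = suc (member c) in sF (n ^ (2 + h)) * q < p * sF n
      ratio {c} c< = begin-strict
        sF (n ^ h') * q                            ≤⟨ *-monoˡ-≤ q (≤-trans (PowerDigits.sF-^ {κ} {n} {c} (member-def c) {m} B≤ h) (digit-bound h m₀)) ⟩
        18 * (h' * h') * m * q                     ≡⟨ swap (18 * (h' * h')) m q ⟩
        18 * (h' * h') * q * m                     <⟨ *-monoˡ-< m Q-def ⟩
        suc Q * p * m                              ≡⟨ swap' (suc Q) p m ⟩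
        p * (suc Q * m)                            ≤⟨ *-monoʳ-≤ p lower ⟩
        p * sF n                                   ∎
        where
        open ≤-Reasoning
        n = suc (member c)
        h' = 2 + h
        swap : ∀ x m q → x * m * q ≡ x * q * m
        swap = solve-∀
        swap' : ∀ x p m → x * p * m ≡ p * (x * m)
        swap' = solve-∀
        B≤ : 9 + 2 * c ≤ Λ (suc m)
        B≤ = begin
          9 + 2 * c              ≡⟨ lem c ⟩
          1 + 2 * (4 + c)        ≤⟨ s≤s (*-monoʳ-≤ 2 (b<Λ c<)) ⟩
          1 + 2 * Λ m            ≤⟨ Λ-double (2 + m₀) ⟩
          Λ (suc m)              ∎
          where
          lem : ∀ c → 9 + 2 * c ≡ 1 + 2 * (4 + c)
          lem = solve-∀
        w = 12 + 5 * m₀ + 3 * Q + Q * m₀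
        κ≡ : κ ≡ m + suc (2 + w)
        κ≡ = lem Q m₀
          where
          lem : ∀ Q m → (6 + Q) * (3 + m) ≡ 3 + m + (3 + (12 + 5 * m + 3 * Q + Q * m))
          lem = solve-∀
        lower : suc Q * m ≤ sF n
        lower = +-cancelʳ-≤ (4 * m) _ _ (begin
          suc Q * m + 4 * m          ≤⟨ m≤m+n _ 4 ⟩
          suc Q * m + 4 * m + 4      ≡⟨ lem Q m₀ ⟩
          7 + w                      ≤⟨ sF-lower {n} {c} {Λ m ∸ (3 + c)} (2 + m₀) w
            (trans (member-def c) (cong (λ k → 2 * Λ (k + k) + (3 + c) * Λ k) κ≡)) (m+[n∸m]≡n (<⇒≤ (b<Λ c<))) ⟩
          sF n + 4 * m               ∎)
          where
          lem : ∀ Q m → (1 + Q) * (3 + m) + 4 * (3 + m) + 4 ≡ 7 + (12 + 5 * m + 3 * Q + Q * m)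
          lem = solve-∀

      L≤length : ∀ {P : ℕ → Set} (P? : Decidable P) → (∀ n → sF (n ^ (2 + h)) * q < p * sF n → P n) →
        ∀ {N} → R m ≤ N → L ≤ length (filter P? (applyUpTo suc (N ∸ 1)))
      L≤length P? P-ratio R≤ = injection⇒≤length (λ i → suc (member (toℕ i)))
        (λ eq → toℕ-injective (member-injective (suc-injective eq)))
        (λ i → ∈-filter⁺ P? (∈-applyUpTo⁺ suc (∸-monoˡ-≤ 1 (member< (toℕ<n i) R≤))) (P-ratio _ (ratio (toℕ<n i))))

    -- Passing from m to m + 1 costs only a constant factor, so an N between consecutive values of
    -- `R` is controlled by the family of the lower one.
    R-bound : ∀ m → R (suc m) ≤ 4 * (3 ^ (2 * K) * Λ m ^ (2 * K))
    R-bound m = begin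
      2 * Λ (k + k) + Λ (suc m) * Λ k             ≤⟨ +-monoʳ-≤ (2 * Λ (k + k)) (*-monoˡ-≤ (Λ k) (Λ-mono {suc m} {k} (m≤m+n (suc m) _))) ⟩
      2 * Λ (k + k) + Λ k * Λ k                   ≡⟨ cong (λ x → 2 * Λ (k + k) + Λ k * Λ x) (+-identityʳ k) ⟨
      2 * Λ (k + k) + Λ k * Λ (k + 0)             ≡⟨ cong (2 * Λ (k + k) +_) (Λ-* Λ Λ-rec k 0) ⟩
      2 * Λ (k + k) + (Λ (k + (k + 0)) + Λ 0)     ≤⟨ +-monoʳ-≤ (2 * Λ (k + k)) (+-mono-≤ (≤-reflexive (cong (λ x → Λ (k + x)) (+-identityʳ k))) (Λ-mono {0} {k + k} z≤n)) ⟩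
      2 * Λ (k + k) + (Λ (k + k) + Λ (k + k))     ≡⟨ lem₁ (Λ (k + k)) ⟩
      4 * Λ (k + k)                               ≡⟨ cong (λ x → 4 * Λ x) (lem₂ K m) ⟩
      4 * Λ (2 * K + 2 * K * m)                   ≤⟨ *-monoʳ-≤ 4 (≤-trans (Λ-+≤ (2 * K) (2 * K * m)) (*-monoʳ-≤ (3 ^ (2 * K)) (Λ-*≤Λ^ (pred (2 * K)) m))) ⟩
      4 * (3 ^ (2 * K) * Λ m ^ (2 * K))           ∎
      where
      open ≤-Reasoning
      k = K * suc m
      lem₁ : ∀ x → 2 * x + (x + x) ≡ 4 * x
      lem₁ = solve-∀
      lem₂ : ∀ K m → K * (1 + m) + K * (1 + m) ≡ 2 * K + 2 * K * m
      lem₂ = solve-∀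

    N≤length^ : ∀ {P : ℕ → Set} (P? : Decidable P) → (∀ n → sF (n ^ (2 + h)) * q < p * sF n → P n) →
      ∀ N → R 3 ≤ N → N ≤ (12 * length (filter P? (applyUpTo suc (N ∸ 1)))) ^ (2 * K)
    N≤length^ P? P-ratio N R₃≤ with last-below (λ k → R (3 + k)) N R₃≤ N<R
      where
      N<R : N < R (3 + N)
      N<R = ≤-trans (≤-trans (s≤s (m≤n+m N 3)) (Λ> (3 + N)))
        (≤-trans (m≤m*n (Λ (3 + N)) (Λ (K * (3 + N))) {{>-nonZero (≤-trans (s≤s z≤n) (Λ> (K * (3 + N))))}}) (m≤n+m _ _))
    ... | k , lo , hi = begin
      N                                    ≤⟨ <⇒≤ hi ⟩
      R (suc (3 + k))                      ≤⟨ R-bound (3 + k) ⟩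
      -- 4 = 2² ≤ 2^D brings the constant under the D-th power; together 2 · 3 · 2 = 12.
      4 * (3 ^ D * Λ (3 + k) ^ D)          ≤⟨ *-mono-≤ (^-monoʳ-≤ 2 {2} {D} (s≤s (s≤s z≤n))) (*-monoʳ-≤ (3 ^ D) (^-monoˡ-≤ D Λ≤)) ⟩
      2 ^ D * (3 ^ D * (2 * ℓ) ^ D)        ≡⟨ cong (2 ^ D *_) (^-distribʳ-* D 3 (2 * ℓ)) ⟨
      2 ^ D * (3 * (2 * ℓ)) ^ D            ≡⟨ ^-distribʳ-* D 2 (3 * (2 * ℓ)) ⟨
      (2 * (3 * (2 * ℓ))) ^ D              ≡⟨ cong (_^ D) (lem ℓ) ⟩
      (12 * ℓ) ^ D                         ∎
      where
      open ≤-Reasoning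
      D = 2 * K
      ℓ = length (filter P? (applyUpTo suc (N ∸ 1)))
      lem : ∀ x → 2 * (3 * (2 * x)) ≡ 12 * x
      lem = solve-∀
      Λ≤ : Λ (3 + k) ≤ 2 * ℓ
      Λ≤ = begin
        Λ (3 + k)                    ≡⟨ m+[n∸m]≡n (≤-trans (m≤m+n 3 3) (6≤Λ k)) ⟨
        -- From Λ ≥ 6 follows 3 ≤ Λ - 3: excluding b < 3 loses at most half of the values.
        3 + L k                      ≤⟨ +-monoˡ-≤ (L k) (∸-monoˡ-≤ 3 (6≤Λ k)) ⟩
        L k + L k                    ≡⟨ cong (L k +_) (+-identityʳ _) ⟨
        2 * L k                      ≤⟨ *-monoʳ-≤ 2 (L≤length k P? P-ratio lo) ⟩
        2 * ℓ                        ∎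

open import Data.Nat using (ℕ; suc) renaming (_≤_ to _≤ℕ_)
open import Data.Product using (Σ; ∃; _×_; _,_)
open import Data.Rational using (ℚ; Positive; _<_; _≤_; _*_; _/_; 1ℚ; mkℚ; _+_; 1/_; toℚᵘ)
open import Data.Integer using (+_; +[1+_])
import Data.Integer as ℤ
import Data.Integer.Properties as ℤ
import Data.Nat as ℕ
open import Data.Nat.DivMod using (m≡m%n+[m/n]*n; m%n<n; m/n*n≤m)
import Data.Nat.Properties as ℕ
open import Data.Nat.Tactic.RingSolver using (solve-∀)
open import Data.Rational.Properties
open import Data.Rational.Unnormalised as ℚᵘ using (mkℚᵘ; *≡*; *≤*; *<*)
import Data.Rational.Unnormalised.Properties as ℚᵘ
open import Relation.Binary.PropositionalEquality

-- Natural numbers inside ℚ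

⟦⟧-≃ : ∀ n → toℚᵘ ⟦ n ⟧ ℚᵘ.≃ mkℚᵘ (+ n) 0
⟦⟧-≃ n = toℚᵘ-fromℚᵘ (mkℚᵘ (+ n) 0)

⟦⟧-mono-≤ : ∀ {m n} → m ℕ.≤ n → ⟦ m ⟧ ≤ ⟦ n ⟧
⟦⟧-mono-≤ {m} {n} m≤n = toℚᵘ-cancel-≤ (begin
  toℚᵘ ⟦ m ⟧     ≃⟨ ⟦⟧-≃ m ⟩
  mkℚᵘ (+ m) 0   ≤⟨ *≤* (ℤ.*-monoʳ-≤-nonNeg (+ 1) (ℤ.+≤+ m≤n)) ⟩
  mkℚᵘ (+ n) 0   ≃⟨ ⟦⟧-≃ n ⟨
  toℚᵘ ⟦ n ⟧     ∎)
  where open ℚᵘ.≤-Reasoning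

⟦⟧-mono-< : ∀ {m n} → m ℕ.< n → ⟦ m ⟧ < ⟦ n ⟧
⟦⟧-mono-< {m} {n} m<n = toℚᵘ-cancel-< (begin-strict
  toℚᵘ ⟦ m ⟧     ≃⟨ ⟦⟧-≃ m ⟩
  mkℚᵘ (+ m) 0   <⟨ *<* (ℤ.*-monoʳ-<-pos (+ 1) (ℤ.+<+ m<n)) ⟩
  mkℚᵘ (+ n) 0   ≃⟨ ⟦⟧-≃ n ⟨
  toℚᵘ ⟦ n ⟧     ∎)
  where open ℚᵘ.≤-Reasoning

⟦⟧-+ : ∀ m n → ⟦ m ℕ.+ n ⟧ ≡ ⟦ m ⟧ + ⟦ n ⟧
⟦⟧-+ m n = toℚᵘ-injective (begin-equality
  toℚᵘ ⟦ m ℕ.+ n ⟧                  ≃⟨ ⟦⟧-≃ (m ℕ.+ n) ⟩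
  mkℚᵘ (+ m ℤ.+ + n) 0              ≡⟨ cong₂ (λ x y → mkℚᵘ (x ℤ.+ y) 0) (ℤ.*-identityʳ (+ m)) (ℤ.*-identityʳ (+ n)) ⟨
  mkℚᵘ (+ m) 0 ℚᵘ.+ mkℚᵘ (+ n) 0    ≃⟨ ℚᵘ.+-cong (⟦⟧-≃ m) (⟦⟧-≃ n) ⟨
  toℚᵘ ⟦ m ⟧ ℚᵘ.+ toℚᵘ ⟦ n ⟧        ≃⟨ toℚᵘ-homo-+ ⟦ m ⟧ ⟦ n ⟧ ⟨
  toℚᵘ (⟦ m ⟧ + ⟦ n ⟧)              ∎)
  where open ℚᵘ.≤-Reasoning

⟦⟧-* : ∀ m n → ⟦ m ℕ.* n ⟧ ≡ ⟦ m ⟧ * ⟦ n ⟧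
⟦⟧-* m n = toℚᵘ-injective (begin-equality
  toℚᵘ ⟦ m ℕ.* n ⟧                  ≃⟨ ⟦⟧-≃ (m ℕ.* n) ⟩
  mkℚᵘ (+ (m ℕ.* n)) 0              ≡⟨ cong (λ x → mkℚᵘ x 0) (ℤ.pos-* m n) ⟩
  mkℚᵘ (+ m) 0 ℚᵘ.* mkℚᵘ (+ n) 0    ≃⟨ ℚᵘ.*-cong (⟦⟧-≃ m) (⟦⟧-≃ n) ⟨
  toℚᵘ ⟦ m ⟧ ℚᵘ.* toℚᵘ ⟦ n ⟧        ≃⟨ toℚᵘ-homo-* ⟦ m ⟧ ⟦ n ⟧ ⟨
  toℚᵘ (⟦ m ⟧ * ⟦ n ⟧)              ∎)
  where open ℚᵘ.≤-Reasoning

/-*-cancel : ∀ k d → + k / suc d * ⟦ suc d ⟧ ≡ ⟦ k ⟧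
/-*-cancel k d = toℚᵘ-injective (begin-equality
  toℚᵘ (+ k / suc d * ⟦ suc d ⟧)                 ≃⟨ toℚᵘ-homo-* (+ k / suc d) ⟦ suc d ⟧ ⟩
  toℚᵘ (+ k / suc d) ℚᵘ.* toℚᵘ ⟦ suc d ⟧         ≃⟨ ℚᵘ.*-cong (toℚᵘ-fromℚᵘ (mkℚᵘ (+ k) d)) (⟦⟧-≃ (suc d)) ⟩
  mkℚᵘ (+ k) d ℚᵘ.* mkℚᵘ (+ suc d) 0             ≃⟨ *≡* (trans (ℤ.*-assoc (+ k) (+ suc d) (+ 1)) (cong (λ x → + k ℤ.* x) (sym (ℤ.pos-* (suc d) 1)))) ⟩
  mkℚᵘ (+ k) 0                                   ≃⟨ ⟦⟧-≃ k ⟨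
  toℚᵘ ⟦ k ⟧                                     ∎)
  where open ℚᵘ.≤-Reasoning

⟦suc⟧-pos : ∀ n → Positive ⟦ suc n ⟧
⟦suc⟧-pos n = normalize-pos (suc n) 1

*-swap : ∀ x y z → x * y * z ≡ x * z * y
*-swap x y z = trans (*-assoc x y z) (trans (cong (x *_) (*-comm y z)) (sym (*-assoc x z y)))

^ℚ-distrib-* : ∀ k x y → (x * y) ^ℚ k ≡ x ^ℚ k * y ^ℚ k
^ℚ-distrib-* ℕ.zero x y = sym (*-identityˡ 1ℚ)
^ℚ-distrib-* (suc k) x y = begin
  x * y * (x * y) ^ℚ k           ≡⟨ cong (x * y *_) (^ℚ-distrib-* k x y) ⟩
  x * y * (x ^ℚ k * y ^ℚ k)      ≡⟨ *-assoc (x * y) (x ^ℚ k) (y ^ℚ k) ⟨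
  x * y * x ^ℚ k * y ^ℚ k        ≡⟨ cong (_* y ^ℚ k) (*-swap x y (x ^ℚ k)) ⟩
  x * x ^ℚ k * y * y ^ℚ k        ≡⟨ *-assoc (x * x ^ℚ k) y (y ^ℚ k) ⟩
  x * x ^ℚ k * (y * y ^ℚ k)      ∎
  where open ≡-Reasoning

⟦⟧-^ : ∀ n k → ⟦ n ℕ.^ k ⟧ ≡ ⟦ n ⟧ ^ℚ k
⟦⟧-^ n ℕ.zero = refl
⟦⟧-^ n (suc k) = trans (⟦⟧-* n (n ℕ.^ k)) (cong (⟦ n ⟧ *_) (⟦⟧-^ n k))

^ℚ-pos : ∀ q .{{_ : Positive q}} k → Positive (q ^ℚ k)
^ℚ-pos q ℕ.zero = _
^ℚ-pos q (suc k) = pos*pos⇒pos q (q ^ℚ k) {{^ℚ-pos q k}}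

power-bound : ∀ N s k ℓ → N ℕ.≤ (suc s ℕ.* ℓ) ℕ.^ k → (+ 1 / suc s) ^ℚ k * ⟦ N ⟧ ^ℚ 1 ≤ ⟦ ℓ ⟧ ^ℚ k
power-bound N s k ℓ N≤ = begin
  C ^ℚ k * (⟦ N ⟧ * 1ℚ)                    ≡⟨ cong (C ^ℚ k *_) (*-identityʳ ⟦ N ⟧) ⟩
  C ^ℚ k * ⟦ N ⟧                           ≤⟨ *-monoˡ-≤-nonNeg (C ^ℚ k) {{pos⇒nonNeg (C ^ℚ k) {{^ℚ-pos C {{normalize-pos 1 (suc s)}} k}}}} (⟦⟧-mono-≤ N≤) ⟩
  C ^ℚ k * ⟦ (suc s ℕ.* ℓ) ℕ.^ k ⟧         ≡⟨ cong (C ^ℚ k *_) (trans (⟦⟧-^ (suc s ℕ.* ℓ) k) (cong (_^ℚ k) (⟦⟧-* (suc s) ℓ))) ⟩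
  C ^ℚ k * (⟦ suc s ⟧ * ⟦ ℓ ⟧) ^ℚ k        ≡⟨ ^ℚ-distrib-* k C _ ⟨
  (C * (⟦ suc s ⟧ * ⟦ ℓ ⟧)) ^ℚ k           ≡⟨ cong (_^ℚ k) (trans (sym (*-assoc C ⟦ suc s ⟧ ⟦ ℓ ⟧)) (trans (cong (_* ⟦ ℓ ⟧) (/-*-cancel 1 s)) (*-identityˡ ⟦ ℓ ⟧))) ⟩
  ⟦ ℓ ⟧ ^ℚ k                               ∎
  where
  open ≤-Reasoning
  C = + 1 / suc s

-- From fractions to ε, and the choice of the exponent

positive-fraction : ∀ ε .{{_ : Positive ε}} → ∃ λ p → ∃ λ d → ε * ⟦ suc d ⟧ ≡ ⟦ suc p ⟧
positive-fraction ε@(mkℚ (+ ℕ.zero) _ _) with *<* (ℤ.+<+ ()) ← toℚᵘ-mono-< (positive⁻¹ ε)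
positive-fraction ε@(mkℚ +[1+ p ] d _) = p , d , trans (cong (_* ⟦ suc d ⟧) (sym (↥p/↧p≡p ε))) (/-*-cancel (suc p) d)
positive-fraction ε@(mkℚ ℤ.-[1+ _ ] _ _) with *<* () ← toℚᵘ-mono-< (positive⁻¹ ε)

module _ (ε : ℚ) (p d : ℕ) (ε-def : ε * ⟦ suc d ⟧ ≡ ⟦ p ⟧) where

  ε-*-⟦⟧ : ∀ s → ε * ⟦ s ⟧ * ⟦ suc d ⟧ ≡ ⟦ p ℕ.* s ⟧
  ε-*-⟦⟧ s = trans (*-swap ε ⟦ s ⟧ ⟦ suc d ⟧) (trans (cong (_* ⟦ s ⟧) ε-def) (sym (⟦⟧-* p s)))

  ratio< : ∀ s t → s ℕ.* suc d ℕ.< p ℕ.* t → ⟦ s ⟧ < ε * ⟦ t ⟧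
  ratio< s t lt = *-cancelʳ-<-nonNeg ⟦ suc d ⟧ {{pos⇒nonNeg ⟦ suc d ⟧ {{⟦suc⟧-pos d}}}}
    (subst₂ _<_ (⟦⟧-* s (suc d)) (sym (ε-*-⟦⟧ t)) (⟦⟧-mono-< lt))

  ≤-*-1/ε : .{{_ : Positive ε}} → ∀ {x y} → p ℕ.* x ℕ.≤ y ℕ.* suc d → ⟦ x ⟧ ≤ ⟦ y ⟧ * (1/ ε) {{pos⇒nonZero ε}}
  ≤-*-1/ε {x} {y} le = *-cancelʳ-≤-pos ε (*-cancelʳ-≤-pos ⟦ suc d ⟧ {{⟦suc⟧-pos d}} (begin
    ⟦ x ⟧ * ε * ⟦ suc d ⟧       ≡⟨ cong (_* ⟦ suc d ⟧) (*-comm ⟦ x ⟧ ε) ⟩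
    ε * ⟦ x ⟧ * ⟦ suc d ⟧       ≡⟨ ε-*-⟦⟧ x ⟩
    ⟦ p ℕ.* x ⟧                 ≤⟨ ⟦⟧-mono-≤ le ⟩
    ⟦ y ℕ.* suc d ⟧             ≡⟨ ⟦⟧-* y (suc d) ⟩
    ⟦ y ⟧ * ⟦ suc d ⟧           ≡⟨ cong (_* ⟦ suc d ⟧) (trans (*-assoc ⟦ y ⟧ ε⁻¹ ε) (trans (cong (⟦ y ⟧ *_) (*-inverseˡ ε {{pos⇒nonZero ε}})) (*-identityʳ ⟦ y ⟧))) ⟨
    ⟦ y ⟧ * ε⁻¹ * ε * ⟦ suc d ⟧ ∎))
    where
    open ≤-Reasoning
    ε⁻¹ = (1/ ε) {{pos⇒nonZero ε}}

  -- Used with x = 2Q, where x + 12 = 2K; strictness comes from 12 < 18.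
  <M : .{{_ : Positive ε}} → ∀ h x → p ℕ.* x ℕ.≤ 36 ℕ.* h ℕ.* h ℕ.* suc d → ⟦ x ℕ.+ 12 ⟧ < M h ε
  <M h x le = begin-strict
    ⟦ x ℕ.+ 12 ⟧       ≡⟨ ⟦⟧-+ x 12 ⟩
    ⟦ x ⟧ + ⟦ 12 ⟧     <⟨ +-mono-≤-< (≤-*-1/ε {x} {36 ℕ.* h ℕ.* h} le) (⟦⟧-mono-< {12} {18} (ℕ.m≤m+n 13 5)) ⟩
    _                  ≤⟨ p≤p⊔q _ ⟦ 8 ℕ.* h ℕ.+ 1 ⟧ ⟩
    M h ε              ∎
    where open ≤-Reasoning

1<1/suc* : ∀ b {y} → ⟦ suc b ⟧ < y → 1ℚ < + 1 / suc b * y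
1<1/suc* b {y} lt = subst (_< + 1 / suc b * y) (/-*-cancel 1 b)
  (*-monoʳ-<-pos (+ 1 / suc b) {{normalize-pos 1 (suc b)}} lt)

m<suc[m/n]*n : ∀ m n .{{_ : ℕ.NonZero n}} → m ℕ.< suc (m ℕ./ n) ℕ.* n
m<suc[m/n]*n m n = subst (ℕ._< suc (m ℕ./ n) ℕ.* n) (sym (m≡m%n+[m/n]*n m n)) (ℕ.+-monoˡ-< (m ℕ./ n ℕ.* n) (m%n<n m n))

module _ (ε : ℚ) .{{_ : Positive ε}} (p d : ℕ) (ε-def : ε * ⟦ suc d ⟧ ≡ ⟦ suc p ⟧) (h Q b : ℕ)
  (b-def : 2 ℕ.* (6 ℕ.+ Q) ≡ suc b)
  (Q-upper : Q ℕ.* suc p ℕ.≤ 18 ℕ.* ((2 ℕ.+ h) ℕ.* (2 ℕ.+ h)) ℕ.* suc d)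
  (Q-lower : 18 ℕ.* ((2 ℕ.+ h) ℕ.* (2 ℕ.+ h)) ℕ.* suc d ℕ.< suc Q ℕ.* suc p) where

  open Arithmetic.Family h (suc p) (suc d) Q Q-lower

  exponent-bound : 1ℚ < (+ 1 / suc b) * M (2 ℕ.+ h) ε
  exponent-bound = 1<1/suc* b (subst (λ x → ⟦ x ⟧ < M (2 ℕ.+ h) ε) (trans (lem₃ Q) b-def) (<M ε (suc p) d ε-def (2 ℕ.+ h) (2 ℕ.* Q) 2Q≤))
    where
    open ℕ.≤-Reasoning
    lem₁ : ∀ p Q → p ℕ.* (2 ℕ.* Q) ≡ 2 ℕ.* (Q ℕ.* p)
    lem₁ = solve-∀
    lem₂ : ∀ h d → 2 ℕ.* (18 ℕ.* ((2 ℕ.+ h) ℕ.* (2 ℕ.+ h)) ℕ.* (1 ℕ.+ d)) ≡ 36 ℕ.* (2 ℕ.+ h) ℕ.* (2 ℕ.+ h) ℕ.* (1 ℕ.+ d)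
    lem₂ = solve-∀
    lem₃ : ∀ Q → 2 ℕ.* Q ℕ.+ 12 ≡ 2 ℕ.* (6 ℕ.+ Q)
    lem₃ = solve-∀
    2Q≤ : suc p ℕ.* (2 ℕ.* Q) ℕ.≤ 36 ℕ.* (2 ℕ.+ h) ℕ.* (2 ℕ.+ h) ℕ.* suc d
    2Q≤ = begin
      suc p ℕ.* (2 ℕ.* Q)                                        ≡⟨ lem₁ (suc p) Q ⟩
      2 ℕ.* (Q ℕ.* suc p)                                        ≤⟨ ℕ.*-monoʳ-≤ 2 Q-upper ⟩
      2 ℕ.* (18 ℕ.* ((2 ℕ.+ h) ℕ.* (2 ℕ.+ h)) ℕ.* suc d)         ≡⟨ lem₂ h d ⟩
      36 ℕ.* (2 ℕ.+ h) ℕ.* (2 ℕ.+ h) ℕ.* suc d                   ∎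

  count-bound : ∀ N → R 3 ≤ℕ N →
    (+ 1 / 12) ^ℚ suc b * ⟦ N ⟧ ^ℚ 1 ≤ ⟦ count (2 ℕ.+ h) ε N ⟧ ^ℚ suc b
  count-bound N R₃≤N = power-bound N 11 (suc b) (count (2 ℕ.+ h) ε N)
    (subst (λ k → N ≤ℕ (12 ℕ.* count (2 ℕ.+ h) ε N) ℕ.^ k) b-def
      (N≤length^ (λ n → ⟦ sF (n ℕ.^ (2 ℕ.+ h)) ⟧ <? ε * ⟦ sF n ⟧) (λ n → ratio< ε (suc p) d ε-def (sF (n ℕ.^ (2 ℕ.+ h))) (sF n)) N R₃≤N))

  conclusion : Σ ℕ λ a → Σ ℕ λ b →
    1ℚ < (+ a / suc b) * M (2 ℕ.+ h) ε ×
    Σ ℚ λ C → Positive C × Σ ℕ λ N₀ → (N : ℕ) → N₀ ≤ℕ N →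
    C ^ℚ suc b * ⟦ N ⟧ ^ℚ a ≤ ⟦ count (2 ℕ.+ h) ε N ⟧ ^ℚ suc b
  conclusion = 1 , b , exponent-bound , + 1 / 12 , normalize-pos 1 12 , R 3 , count-bound

theorem3 : (h : ℕ) → 2 ≤ℕ h → (ε : ℚ) → .{{_ : Positive ε}} →
    Σ ℕ λ a → Σ ℕ λ b →
    1ℚ < (+ a / suc b) * M h ε ×
    Σ ℚ λ C → Positive C × Σ ℕ λ N₀ → (N : ℕ) → N₀ ≤ℕ N →
    C ^ℚ suc b * ⟦ N ⟧ ^ℚ a ≤ ⟦ count h ε N ⟧ ^ℚ suc b
theorem3 (suc (suc h)) (ℕ.s≤s (ℕ.s≤s ℕ.z≤n)) ε =
  let p , d , ε-def = positive-fraction ε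
      -- `Q` is the integer part of 18 h²/ε, for the exponent 2 + h: `suc Q` exceeds this quotient,
      -- as the ratio requires, while 2Q ≤ 36 h²/ε.
      Q₀ = 18 ℕ.* ((2 ℕ.+ h) ℕ.* (2 ℕ.+ h)) ℕ.* suc d
      Q = Q₀ ℕ./ suc p
  in conclusion ε p d ε-def h Q (11 ℕ.+ 2 ℕ.* Q) (ℕ.*-distribˡ-+ 2 6 Q) (m/n*n≤m Q₀ (suc p)) (m<suc[m/n]*n Q₀ (suc p))
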